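{- For all integers $r,s\ge 1$, $\chi_{ltna}(rK_2\vee C_{2s+1})=5$.
   Context: All graphs are finite and simple. $rK_2$ is the disjoint union of $r$ copies of $K_2$. $C_k$ is the cycle on $k$ vertices. The join $G\vee H$ of (vertex-disjoint) graphs has $V(G\vee H)=V(G)\cup V(H)$ and $E(G\vee H)=E(G)\cup E(H)\cup\{uv\mid u\in V(G),v\in V(H)\}$. For a graph $G=(V,E)$ of order $p$ and size $q$ without isolated vertices, a bijection $f:V\cup E\to\{1,\dots,p+q\}$ is a local total neighborhood antimagic labeling of $G$ if the induced vertex coloring $f^+_{tn}(u)=\sum_{ux\in E}[f(ux)+f(x)]$ satisfies $f^+_{tn}(u)\ne f^+_{tn}(v)$ for every edge $uv\in E$. The number of distinct induced colors is $c_{tn}(f)$. The local total neighborhood antimagic chromatic number $\chi_{ltna}(G)$ is the minimum of $c_{tn}(f)$ over all local total neighborhood antimagic labelings $f$ of $G$; an assertion $\chi_{ltna}(G)=k$ includes the assertion that $G$ admits such a labeling. -}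

module Defs where

import Algebra.Properties.Monoid.Sum as Sum
open import Data.Bool.Base using (if_then_else_)
open import Data.Fin.Base using (Fin; zero; suc; toℕ)
open import Data.Fin.Properties using (+↔⊎; *↔×; inj⇒≟; toℕ<n; toℕ-fromℕ<)
open import Data.List.Base using (length; tabulate; deduplicate)
open import Data.Nat.Base using (ℕ; zero; suc; _+_; _*_; _%_; _≤_; s≤s)
open import Data.Nat.DivMod using (_mod_; m%n<n; m<n⇒m%n≡m; n%n≡0)
open import Data.Nat.Properties
  using (_≟_; +-0-monoid; m≤n⇒m<n∨m≡n; suc-injective)
open import Data.Product.Base using (∃; _×_; _,_; proj₁; proj₂; map; swap)
open import Data.Product.Function.NonDependent.Propositional using (_×-↔_)
open import Data.Product.Properties using (,-injectiveˡ; ,-injectiveʳ)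
open import Data.Sum.Base using (_⊎_; inj₁; inj₂)
open import Data.Sum.Function.Propositional using (_⊎-↔_)
open import Data.Sum.Properties using (inj₁-injective; inj₂-injective)
open import Function.Base using (_∘_)
open import Function.Bundles using (_↔_; _⤖_; module Inverse; module Bijection)
open import Function.Construct.Composition using (_↔-∘_)
open import Function.Construct.Identity using (↔-id)
open import Function.Construct.Symmetry using (↔-sym)
open import Function.Definitions using (Injective)
open import Function.Properties.Inverse using (↔⇒↣)
open import Relation.Binary.Definitions using (DecidableEquality)
open import Relation.Binary.PropositionalEquality
  using (_≡_; _≢_; refl; sym; trans; cong; cong₂)
open import Relation.Nullary using (¬_; does)

open Sum +-0-monoid using (sum-syntax)

-- A finite simple graph, presented through an arbitrary orientation: `ends`
-- lists the two ends of each edge in some order, which carries no information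
-- (`Adj` and the induced colouring below are symmetric in it).
-- `ends-injective` and `ends-asym` together say that distinct edges have
-- distinct end sets; `ends-asym` with e = e′ also excludes loops.
record Graph : Set₁ where
  field
    V E            : Set
    order size     : ℕ
    V-finite       : V ↔ Fin order
    E-finite       : E ↔ Fin size
    ends           : E → V × V
    ends-injective : Injective _≡_ _≡_ ends
    ends-asym      : ∀ e e′ → ends e ≢ swap (ends e′)

  Adj : V → V → Set
  Adj u v = ∃ λ e → ends e ≡ (u , v) ⊎ ends e ≡ (v , u)

  vertex : Fin order → V
  vertex = Inverse.from V-finite

  edge : Fin size → E
  edge = Inverse.from E-finite

  _≟ⱽ_ : DecidableEquality V
  _≟ⱽ_ = inj⇒≟ (↔⇒↣ V-finite)

K₂ : Graph
K₂ = record
  { V              = Fin 2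
  ; E              = Fin 1
  ; order          = 2
  ; size           = 1
  ; V-finite       = ↔-id _
  ; E-finite       = ↔-id _
  ; ends           = λ _ → zero , suc zero
  ; ends-injective = λ { {zero} {zero} _ → refl }
  ; ends-asym      = λ _ _ ()
  }

-- The disjoint union of r copies of G.
copies : ℕ → Graph → Graph
copies r G = record
  { V              = Fin r × V
  ; E              = Fin r × E
  ; order          = r * order
  ; size           = r * size
  ; V-finite       = ↔-sym *↔× ↔-∘ (↔-id _ ×-↔ V-finite)
  ; E-finite       = ↔-sym *↔× ↔-∘ (↔-id _ ×-↔ E-finite)
  ; ends           = λ (i , e) → map (i ,_) (i ,_) (ends e)
  ; ends-injective = λ eq → cong₂ _,_ (cong (proj₁ ∘ proj₁) eq)
                              (ends-injective (cong (map proj₂ proj₂) eq))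
  ; ends-asym      = λ (_ , e) (_ , e′) eq →
                       ends-asym e e′ (cong (map proj₂ proj₂) eq)
  }
  where open Graph G

private
  next-cases : ∀ {n} (i : Fin (suc n)) {j} → suc (toℕ i) mod suc n ≡ j →
    toℕ j ≡ suc (toℕ i) ⊎ (suc (toℕ i) ≡ suc n × toℕ j ≡ 0)
  next-cases {n} i refl with m≤n⇒m<n∨m≡n (toℕ<n i)
  ... | inj₁ lt = inj₁ (trans (toℕ-fromℕ< (m%n<n (suc (toℕ i)) (suc n)))
                              (m<n⇒m%n≡m lt))
  ... | inj₂ eq = inj₂ (eq , trans (toℕ-fromℕ< (m%n<n (suc (toℕ i)) (suc n)))
                              (trans (cong (_% suc n) eq) (n%n≡0 (suc n))))

  no-2-cycle : ∀ {n} → 3 ≤ suc n → (i j : Fin (suc n)) →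
    suc (toℕ i) mod suc n ≡ j → ¬ (suc (toℕ j) mod suc n ≡ i)
  no-2-cycle h i j p q = go h (next-cases i p) (next-cases j q)
    where
    n≢2+n : ∀ {m} → m ≢ suc (suc m)
    n≢2+n {zero}  ()
    n≢2+n {suc m} eq = n≢2+n (suc-injective eq)

    go : ∀ {a b k} → 3 ≤ k → b ≡ suc a ⊎ (suc a ≡ k × b ≡ 0) →
         ¬ (a ≡ suc b ⊎ (suc b ≡ k × a ≡ 0))
    go _              (inj₁ x)             (inj₁ y)             = n≢2+n (trans x (cong suc y))
    go (s≤s (s≤s ())) (inj₁ refl)          (inj₂ (refl , refl))
    go (s≤s (s≤s ())) (inj₂ (refl , refl)) (inj₁ refl)

-- Edge i of the cycle joins the vertices i and i + 1 (mod k).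
cycle : (k : ℕ) → 3 ≤ k → Graph
cycle k@(suc _) 3≤k = record
  { V              = Fin k
  ; E              = Fin k
  ; order          = k
  ; size           = k
  ; V-finite       = ↔-id _
  ; E-finite       = ↔-id _
  ; ends           = λ i → i , suc (toℕ i) mod k
  ; ends-injective = ,-injectiveˡ
  ; ends-asym      = λ i j eq →
                       no-2-cycle 3≤k i j (,-injectiveʳ eq) (sym (,-injectiveˡ eq))
  }

infixr 6 _∨_

_∨_ : Graph → Graph → Graph
G ∨ H = record
  { V              = G.V ⊎ H.V
  ; E              = G.E ⊎ H.E ⊎ (G.V × H.V)
  ; order          = G.order + H.order
  ; size           = G.size + (H.size + G.order * H.order)
  ; V-finite       = ↔-sym +↔⊎ ↔-∘ (G.V-finite ⊎-↔ H.V-finite)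
  ; E-finite       = ↔-sym +↔⊎ ↔-∘ (G.E-finite ⊎-↔
                       (↔-sym +↔⊎ ↔-∘ (H.E-finite ⊎-↔
                         (↔-sym *↔× ↔-∘ (G.V-finite ×-↔ H.V-finite)))))
  ; ends           = ends
  ; ends-injective = λ {e} {e′} → injective e e′
  ; ends-asym      = asym
  }
  where
  module G = Graph G
  module H = Graph H

  ends : G.E ⊎ H.E ⊎ (G.V × H.V) → (G.V ⊎ H.V) × (G.V ⊎ H.V)
  ends (inj₁ e)        = map inj₁ inj₁ (G.ends e)
  ends (inj₂ (inj₁ e)) = map inj₂ inj₂ (H.ends e)
  ends (inj₂ (inj₂ p)) = map inj₁ inj₂ p

  unmap₁ : ∀ {p q : G.V × G.V} →
           map {Q = λ _ → G.V ⊎ H.V} inj₁ inj₁ p ≡ map inj₁ inj₁ q → p ≡ q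
  unmap₁ eq = cong₂ _,_ (inj₁-injective (,-injectiveˡ eq)) (inj₁-injective (,-injectiveʳ eq))

  unmap₂ : ∀ {p q : H.V × H.V} →
           map {Q = λ _ → G.V ⊎ H.V} inj₂ inj₂ p ≡ map inj₂ inj₂ q → p ≡ q
  unmap₂ eq = cong₂ _,_ (inj₂-injective (,-injectiveˡ eq)) (inj₂-injective (,-injectiveʳ eq))

  injective : ∀ e e′ → ends e ≡ ends e′ → e ≡ e′
  injective (inj₁ _)        (inj₁ _)        eq = cong inj₁ (G.ends-injective (unmap₁ eq))
  injective (inj₂ (inj₁ _)) (inj₂ (inj₁ _)) eq = cong (inj₂ ∘ inj₁) (H.ends-injective (unmap₂ eq))
  injective (inj₂ (inj₂ _)) (inj₂ (inj₂ _)) refl = refl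
  injective (inj₁ _)        (inj₂ (inj₁ _)) ()
  injective (inj₁ _)        (inj₂ (inj₂ _)) ()
  injective (inj₂ (inj₁ _)) (inj₁ _)        ()
  injective (inj₂ (inj₁ _)) (inj₂ (inj₂ _)) ()
  injective (inj₂ (inj₂ _)) (inj₁ _)        ()
  injective (inj₂ (inj₂ _)) (inj₂ (inj₁ _)) ()

  asym : ∀ e e′ → ends e ≢ swap (ends e′)
  asym (inj₁ e)        (inj₁ e′)        eq = G.ends-asym e e′ (unmap₁ eq)
  asym (inj₂ (inj₁ e)) (inj₂ (inj₁ e′)) eq = H.ends-asym e e′ (unmap₂ eq)
  asym (inj₂ (inj₂ _)) (inj₂ (inj₂ _))  ()
  asym (inj₁ _)        (inj₂ (inj₁ _))  ()
  asym (inj₁ _)        (inj₂ (inj₂ _))  ()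
  asym (inj₂ (inj₁ _)) (inj₁ _)         ()
  asym (inj₂ (inj₁ _)) (inj₂ (inj₂ _))  ()
  asym (inj₂ (inj₂ _)) (inj₁ _)         ()
  asym (inj₂ (inj₂ _)) (inj₂ (inj₁ _))  ()

module _ (G : Graph) where
  open Graph G

  -- A bijection f : V ∪ E → {1, …, order + size}, with the label k + 1
  -- represented by k : Fin (order + size).
  Labelling : Set
  Labelling = (V ⊎ E) ⤖ Fin (order + size)

  label : Labelling → V ⊎ E → ℕ
  label f x = suc (toℕ (Bijection.to f x))

  -- The term f(ux) + f(x) if e is an edge ux incident with u, otherwise 0.
  contribution : Labelling → V → E → ℕ
  contribution f u e =
    let (a , b) = ends e in
    if does (u ≟ⱽ a) then label f (inj₂ e) + label f (inj₁ b)
    else if does (u ≟ⱽ b) then label f (inj₂ e) + label f (inj₁ a)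
    else 0

  colour : Labelling → V → ℕ
  colour f u = ∑[ k < size ] contribution f u (edge k)

  record IsLocalTotalNeighbourhoodAntimagic (f : Labelling) : Set where
    field
      no-isolated : ∀ u → ∃ λ v → Adj u v
      proper      : ∀ {u v} → Adj u v → colour f u ≢ colour f v

  -- c_tn(f)
  #colours : Labelling → ℕ
  #colours f = length (deduplicate _≟_ (tabulate (colour f ∘ vertex)))

record χₗₜₙₐ[_]≡_ (G : Graph) (k : ℕ) : Set where
  field
    attained : ∃ λ f → IsLocalTotalNeighbourhoodAntimagic G f × #colours G f ≡ k
    minimal  : ∀ f → IsLocalTotalNeighbourhoodAntimagic G f → k ≤ #colours G f

{-# OPTIONS --safe #-}

-- Five colours are needed because an edge of rK₂ and the odd cycle are completely joined.
--
-- For a labelling with five colours let n = 2s + 1 and let N be the number of labels. The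
-- vertices and edges of rK₂ take the 3r labels in the middle, in such a way that e + a and e + b
-- do not depend on the copy of K₂ with ends a, b and edge e. The two edges joining a copy of K₂
-- to the same cycle vertex have complementary labels (their sum is N + 1), and so have the cycle
-- vertex j and the cycle edge from j to j + 1. Hence, with x j the label of the cycle vertex j,
-- its colour is W + x (j + 1) − x j for a constant W. Interleaving two progressions α + i and β +
-- i gives differences β − α, α + 1 − β, alternately, and −s once, at the end. The colour of an
-- end of a copy of K₂ varies only with the sum of the labels joining it to the cycle, which can
-- be made independent of the copy. Finally, both colours on rK₂ are smaller than those on the
-- cycle if s ≤ r, and larger if s > r.
module Submission where

open import Defs
open import Data.Nat.Base
  using (ℕ; zero; suc; _+_; _*_; _∸_; _≤_; _<_; z≤n; s≤s; s≤s⁻¹; _%_; _/_;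
         NonZero; >-nonZero; >-nonZero⁻¹)
open import Data.Nat.Properties using (+-0-commutativeMonoid; *-monoʳ-≤)
open import Algebra.Properties.CommutativeMonoid.Sum +-0-commutativeMonoid
  using (sum-syntax; sum-cong-≗; ∑-distrib-+)
open import Data.Fin.Base
  using (Fin; zero; suc; toℕ; fromℕ<; opposite; _↑ʳ_; splitAt; remQuot; punchOut)
open import Data.Fin.Properties
  using (+↔⊎; _≟_; any?; suc-injective; punchOut-injective; injective⇒≤; splitAt-↑ʳ;
         toℕ-injective; toℕ-fromℕ<; toℕ<n)
open import Data.List.Base using (List; []; _∷_; length; tabulate; lookup)
open import Data.List.Membership.Propositional using (_∈_)
open import Data.List.Membership.Propositional.Properties
  using (∈-tabulate⁺; ∈-tabulate⁻; ∈-deduplicate⁺; ∈-deduplicate⁻; ∈-lookup)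
open import Data.List.Membership.Setoid.Properties using (index-injective)
open import Data.List.Relation.Binary.Subset.Propositional using (_⊆_)
open import Data.List.Relation.Unary.All as All using ([]; _∷_)
open import Data.List.Relation.Unary.AllPairs using ([]; _∷_)
open import Data.List.Relation.Unary.Any using (here; there; index)
open import Data.List.Relation.Unary.Unique.DecPropositional.Properties using (deduplicate-!)
open import Data.List.Relation.Unary.Unique.Propositional using (Unique)
open import Data.Nat.DivMod
  using (_mod_; m%n<n; m≡m%n+[m/n]*n; [m+kn]%n≡m%n; [m+n]%n≡m%n; n%n≡0; m<n⇒m%n≡m;
         m<n*o⇒m/o<n)
import Data.Nat.Properties as ℕ
open import Data.Nat.Tactic.RingSolver using (solve-∀)
open import Data.Product.Base as Prod using (∃; _×_; _,_; proj₁; proj₂)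
open import Data.Product.Properties using (,-injectiveˡ; ,-injectiveʳ)
open import Data.Sum.Base as Sum using (_⊎_; inj₁; inj₂)
open import Data.Sum.Function.Propositional using (_⊎-↔_)
open import Data.Sum.Properties using (inj₁-injective; inj₂-injective)
open import Function.Base using (_∘_)
open import Function.Bundles
  using (_↔_; _⤖_; module Injection; module Inverse; module Bijection; mk↔ₛ′)
open import Function.Construct.Composition using (_↔-∘_)
open import Function.Construct.Symmetry using (↔-sym)
open import Function.Definitions using (Injective)
open import Function.Properties.Inverse using (↔⇒⤖; ↔⇒↣)
open import Relation.Binary.PropositionalEquality
  using (_≡_; _≢_; refl; sym; trans; cong; cong₂; subst; setoid; module ≡-Reasoning)
open import Relation.Nullary using (yes; no; contradiction)
open import Relation.Nullary.Decidable using (dec-true; dec-false)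
open ≡-Reasoning

-- Finite sums

∑-zero : ∀ {n} (g : Fin n → ℕ) → (∀ i → g i ≡ 0) → ∑[ i < n ] g i ≡ 0
∑-zero {zero}  g g≡0 = refl
∑-zero {suc n} g g≡0 = cong₂ _+_ (g≡0 zero) (∑-zero (g ∘ suc) (g≡0 ∘ suc))

∑-supp₁ : ∀ {n} (g : Fin n → ℕ) i → (∀ j → j ≢ i → g j ≡ 0) → ∑[ j < n ] g j ≡ g i
∑-supp₁ g zero    off =
  trans (cong (g zero +_) (∑-zero (g ∘ suc) λ j → off (suc j) λ ())) (ℕ.+-identityʳ _)
∑-supp₁ g (suc i) off =
  cong₂ _+_ (off zero λ ()) (∑-supp₁ (g ∘ suc) i λ j j≢i → off (suc j) (j≢i ∘ suc-injective))

∑-supp₂ : ∀ {n} (g : Fin n → ℕ) i i′ → i ≢ i′ →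
          (∀ j → j ≢ i → j ≢ i′ → g j ≡ 0) → ∑[ j < n ] g j ≡ g i + g i′
∑-supp₂ g zero    zero     i≢i′ off = contradiction refl i≢i′
∑-supp₂ g zero    (suc i′) i≢i′ off =
  cong (g zero +_) (∑-supp₁ (g ∘ suc) i′ λ j j≢ → off (suc j) (λ ()) (j≢ ∘ suc-injective))
∑-supp₂ g (suc i) zero     i≢i′ off =
  trans (cong (g zero +_) (∑-supp₁ (g ∘ suc) i λ j j≢ → off (suc j) (j≢ ∘ suc-injective) (λ ())))
        (ℕ.+-comm (g zero) _)
∑-supp₂ g (suc i) (suc i′) i≢i′ off =
  cong₂ _+_ (off zero (λ ()) (λ ()))
    (∑-supp₂ (g ∘ suc) i i′ (i≢i′ ∘ cong suc)
      λ j p q → off (suc j) (p ∘ suc-injective) (q ∘ suc-injective))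

∑-const : ∀ n c → ∑[ i < n ] c ≡ n * c
∑-const zero    c = refl
∑-const (suc n) c = cong (c +_) (∑-const n c)

∑-splitAt : ∀ m {n} (g : Fin m ⊎ Fin n → ℕ) →
  ∑[ k < m + n ] g (splitAt m k) ≡ ∑[ i < m ] g (inj₁ i) + ∑[ j < n ] g (inj₂ j)
∑-splitAt zero    g = refl
∑-splitAt (suc m) g = trans (cong (g (inj₁ zero) +_) (trans (sum-cong-≗ eq) (∑-splitAt m g′)))
                            (sym (ℕ.+-assoc (g (inj₁ zero)) _ _))
  where
  g′ : Fin m ⊎ _ → ℕ
  g′ = g ∘ Sum.map₁ suc
  eq : ∀ k → g (splitAt (suc m) (suc k)) ≡ g′ (splitAt m k)
  eq k = refl

∑-remQuot : ∀ m {n} (g : Fin m × Fin n → ℕ) →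
  ∑[ k < m * n ] g (remQuot n k) ≡ ∑[ i < m ] ∑[ j < n ] g (i , j)
∑-remQuot zero        g = refl
∑-remQuot (suc m) {n} g =
  trans (sum-cong-≗ eq) (trans (∑-splitAt n g′)
    (cong₂ _+_ refl (∑-remQuot m (g ∘ Prod.map₁ suc))))
  where
  g′ : Fin n ⊎ Fin (m * n) → ℕ
  g′ (inj₁ j) = g (zero , j)
  g′ (inj₂ k) = g (Prod.map₁ suc (remQuot n k))
  eq : ∀ k → g (remQuot n k) ≡ g′ (splitAt n k)
  eq k with splitAt n k
  ... | inj₁ j = refl
  ... | inj₂ k′ = refl

-- Sums over the edges of joins and of copies

module _ (G H : Graph) where
  private
    module G = Graph G
    module H = Graph H
    module GH = Graph (G ∨ H)

  ∑-edges-∨ : (g : GH.E → ℕ) → ∑[ k < GH.size ] g (GH.edge k) ≡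
    ∑[ k < G.size ] g (inj₁ (G.edge k)) +
    (∑[ k < H.size ] g (inj₂ (inj₁ (H.edge k))) +
     ∑[ i < G.order ] ∑[ j < H.order ] g (inj₂ (inj₂ (G.vertex i , H.vertex j))))
  ∑-edges-∨ g =
    trans (trans (sum-cong-≗ eq₁) (∑-splitAt G.size g₁))
          (cong₂ _+_ refl (trans (trans (sum-cong-≗ eq₂) (∑-splitAt H.size g₂))
                              (cong₂ _+_ refl (∑-remQuot G.order _))))
    where
    g₁ : Fin G.size ⊎ Fin (H.size + G.order * H.order) → ℕ
    g₁ (inj₁ k) = g (inj₁ (G.edge k))
    -- The second block is kept as `GH.edge` of a shifted index, so that `eq₂` can split it once
    -- more.
    g₁ (inj₂ k) = g (GH.edge (G.size ↑ʳ k))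
    g₂ : Fin H.size ⊎ Fin (G.order * H.order) → ℕ
    g₂ (inj₁ k) = g (inj₂ (inj₁ (H.edge k)))
    g₂ (inj₂ k) = let (i , j) = remQuot H.order k in g (inj₂ (inj₂ (G.vertex i , H.vertex j)))
    eq₁ : ∀ k → g (GH.edge k) ≡ g₁ (splitAt G.size k)
    eq₁ k with splitAt G.size k in eq
    ... | inj₁ _ = refl
    ... | inj₂ k′ rewrite splitAt-↑ʳ G.size (H.size + G.order * H.order) k′ = refl
    eq₂ : ∀ k → g (GH.edge (G.size ↑ʳ k)) ≡ g₂ (splitAt H.size k)
    eq₂ k rewrite splitAt-↑ʳ G.size (H.size + G.order * H.order) k with splitAt H.size k
    ... | inj₁ _ = refl
    ... | inj₂ _ = refl

∑-edges-copies : ∀ r G → let open Graph (copies r G) in (g : E → ℕ) →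
  ∑[ k < size ] g (edge k) ≡ ∑[ i < r ] ∑[ k < Graph.size G ] g (i , Graph.edge G k)
∑-edges-copies r G g = ∑-remQuot r _

∑-vertices-copies : ∀ r G → let open Graph (copies r G) in (g : V → ℕ) →
  ∑[ k < order ] g (vertex k) ≡ ∑[ i < r ] ∑[ k < Graph.order G ] g (i , Graph.vertex G k)
∑-vertices-copies r G g = ∑-remQuot r _

-- The contribution of one edge to a colour

module _ (G : Graph) (f : Labelling G) where
  open Graph G

  contribution-fst : ∀ u e {b} → ends e ≡ (u , b) →
    contribution G f u e ≡ label G f (inj₂ e) + label G f (inj₁ b)
  contribution-fst u e refl rewrite dec-true (u ≟ⱽ u) refl = refl

  -- The first end is tested before the second, so this case must exclude that `u` is also the first
  -- end.
  contribution-snd : ∀ u e {a} → a ≢ u → ends e ≡ (a , u) →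
    contribution G f u e ≡ label G f (inj₂ e) + label G f (inj₁ a)
  contribution-snd u e {a} a≢u refl
    rewrite dec-false (u ≟ⱽ a) (a≢u ∘ sym) | dec-true (u ≟ⱽ u) refl = refl

  contribution-off : ∀ u e {a b} → a ≢ u → b ≢ u → ends e ≡ (a , b) → contribution G f u e ≡ 0
  contribution-off u e {a} {b} a≢u b≢u refl
    rewrite dec-false (u ≟ⱽ a) (a≢u ∘ sym) | dec-false (u ≟ⱽ b) (b≢u ∘ sym) = refl

-- Counting colours

unique-lookup-injective : ∀ {A : Set} {xs : List A} → Unique xs →
                          Injective _≡_ _≡_ (lookup xs)
unique-lookup-injective (x∉ ∷ xs!) {zero}  {zero}  eq = refl
unique-lookup-injective (x∉ ∷ xs!) {zero}  {suc j} eq =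
  contradiction eq (All.lookup x∉ (∈-lookup j))
unique-lookup-injective (x∉ ∷ xs!) {suc i} {zero}  eq =
  contradiction (sym eq) (All.lookup x∉ (∈-lookup i))
unique-lookup-injective (x∉ ∷ xs!) {suc i} {suc j} eq = cong suc (unique-lookup-injective xs! eq)

-- Pigeonhole: sending a position in `xs` to one of the same value in `ys` is injective, since `xs`
-- has no repetitions.
unique-⊆-length : ∀ {A : Set} {xs ys : List A} → Unique xs → xs ⊆ ys → length xs ≤ length ys
unique-⊆-length {A} xs! xs⊆ys = injective⇒≤ {f = λ i → index (xs⊆ys (∈-lookup i))}
  λ eq → unique-lookup-injective xs! (index-injective (setoid A) _ _ eq)

module _ (G : Graph) (f : Labelling G) where
  open Graph G

  colour-vertex : ∀ v → ∃ λ k → colour G f (vertex k) ≡ colour G f v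
  colour-vertex v = Inverse.to V-finite v , cong (colour G f) (Inverse.strictlyInverseʳ V-finite v)

  #colours≥ : ∀ {xs} → Unique xs → (∀ {x} → x ∈ xs → ∃ λ v → x ≡ colour G f v) →
              length xs ≤ #colours G f
  #colours≥ xs! used = unique-⊆-length xs! λ x∈ → ∈-deduplicate⁺ ℕ._≟_ (mem (used x∈))
    where
    mem : ∀ {x} → (∃ λ v → x ≡ colour G f v) → x ∈ tabulate (colour G f ∘ vertex)
    mem (v , refl) with k , eq ← colour-vertex v = subst (_∈ _) eq (∈-tabulate⁺ k)

  #colours≤ : ∀ xs → (∀ v → colour G f v ∈ xs) → #colours G f ≤ length xs
  #colours≤ xs cover = unique-⊆-length (deduplicate-! ℕ._≟_ _) λ x∈ →
    let (k , eq) = ∈-tabulate⁻ (∈-deduplicate⁻ ℕ._≟_ (tabulate (colour G f ∘ vertex)) x∈)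
    in subst (_∈ xs) (sym eq) (cover (vertex k))

-- Bijections obtained by counting

-- Punching out a missed value `y` would inject `suc n` points into `n`.
injective⇒surjective : ∀ {n} (g : Fin n → Fin n) → Injective _≡_ _≡_ g → ∀ y → ∃ λ x → g x ≡ y
injective⇒surjective {suc n} g inj y with any? (λ x → g x ≟ y)
... | yes hit  = hit
... | no  miss = contradiction
  (injective⇒≤ {f = λ x → punchOut (y≢g x)}
    λ eq → inj (punchOut-injective (y≢g _) (y≢g _) eq)) ℕ.1+n≰n
  where
  y≢g : ∀ x → y ≢ g x
  y≢g x eq = miss (x , sym eq)

-- A section of F is an injection between sets of equal size, hence a bijection, and F is its inverse.
module _ {X : Set} {n} (X↔ : X ↔ Fin n) (F : X → ℕ)
         (hit : ∀ (l : Fin n) → ∃ λ x → F x ≡ toℕ l) where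
  private
    g : Fin n → X
    g = proj₁ ∘ hit
    g-injective : Injective _≡_ _≡_ g
    g-injective {l} {l′} eq = toℕ-injective
      (trans (sym (proj₂ (hit l))) (trans (cong F eq) (proj₂ (hit l′))))
    to-injective : Injective _≡_ _≡_ (Inverse.to X↔)
    to-injective = Injection.injective (↔⇒↣ X↔)
    preimage : ∀ x → ∃ λ l → g l ≡ x
    preimage x =
      let (l , eq) = injective⇒surjective (Inverse.to X↔ ∘ g) (g-injective ∘ to-injective)
                                          (Inverse.to X↔ x)
      in l , to-injective eq

  covering⇒bijection : ∃ λ (f : X ⤖ Fin n) → ∀ x → toℕ (Bijection.to f x) ≡ F x
  covering⇒bijection =
    ↔⇒⤖ (mk↔ₛ′ (proj₁ ∘ preimage) g (λ l → g-injective (proj₂ (preimage (g l))))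
               (proj₂ ∘ preimage)) ,
    λ x → trans (sym (proj₂ (hit _))) (cong F (proj₂ (preimage x)))

-- The lower bound

-- With the two values `C 0` and `C 1` alone the walk would alternate, giving `C (s + s) ≡ C 0`; but
-- the next value is `C 0` again, as the walk closes after an odd number of steps.
third-colour : (C : ℕ → ℕ) → (∀ j → C j ≢ C (suc j)) → ∀ s → C (suc (s + s)) ≡ C 0 →
               ∃ λ j → C j ≢ C 0 × C j ≢ C 1
third-colour C adj s closed with alternating s
  where
  alternating : ∀ i → (∃ λ j → C j ≢ C 0 × C j ≢ C 1) ⊎ C (i + i) ≡ C 0
  alternating zero = inj₂ refl
  alternating (suc i) rewrite ℕ.+-suc i i with alternating i
  ... | inj₁ found = inj₁ found
  ... | inj₂ even with C (suc (i + i)) ℕ.≟ C 1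
  ...   | no  odd≢ = inj₁ (_ , (λ eq → adj (i + i) (trans even (sym eq))) , odd≢)
  ...   | yes odd with C (suc (suc (i + i))) ℕ.≟ C 0
  ...     | yes even′ = inj₂ even′
  ...     | no  even≢ = inj₁ (_ , even≢ , λ eq → adj (suc (i + i)) (trans odd (sym eq)))
... | inj₁ found = found
... | inj₂ even  = contradiction (trans even (sym closed)) (adj (s + s))

suc-mod : ∀ j n .{{_ : NonZero n}} → suc (toℕ (j mod n)) mod n ≡ suc j mod n
suc-mod j n = toℕ-injective (trans (toℕ-fromℕ< _) (trans eq (sym (toℕ-fromℕ< _))))
  where
  eq : suc (toℕ (j mod n)) % n ≡ suc j % n
  eq rewrite toℕ-fromℕ< (m%n<n j n) = sym
    (trans (cong (λ k → suc k % n) (m≡m%n+[m/n]*n j n)) ([m+kn]%n≡m%n (suc (j % n)) (j / n) n))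

module _ (G : Graph) (f : Labelling G) (antimagic : IsLocalTotalNeighbourhoodAntimagic G f) where
  open Graph G
  open IsLocalTotalNeighbourhoodAntimagic antimagic

  -- The closed walk `w` of odd length carries three colours, and `u` and `v`, adjacent to each
  -- other and to all of `w`, carry two more.
  edge∨odd-cycle⇒5≤#colours :
    ∀ {u v} (w : ℕ → V) s → Adj u v → (∀ j → Adj u (w j)) → (∀ j → Adj v (w j)) →
    (∀ j → Adj (w j) (w (suc j))) → w (suc (s + s)) ≡ w 0 → 5 ≤ #colours G f
  edge∨odd-cycle⇒5≤#colours {u} {v} w s uv uw vw ww closed = #colours≥ G f distinct used
    where
    C : ℕ → ℕ
    C j = colour G f (w j)

    j₃ : ∃ λ j → C j ≢ C 0 × C j ≢ C 1
    j₃ = third-colour C (proper ∘ ww) s (cong (colour G f) closed)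

    colours : List ℕ
    colours = colour G f u ∷ colour G f v ∷ C 0 ∷ C 1 ∷ C (proj₁ j₃) ∷ []

    distinct : Unique colours
    distinct =
      (proper uv ∷ proper (uw 0) ∷ proper (uw 1) ∷ proper (uw _) ∷ []) ∷
      (proper (vw 0) ∷ proper (vw 1) ∷ proper (vw _) ∷ []) ∷
      (proper (ww 0) ∷ proj₁ (proj₂ j₃) ∘ sym ∷ []) ∷
      (proj₂ (proj₂ j₃) ∘ sym ∷ []) ∷ [] ∷ []

    used : ∀ {x} → x ∈ colours → ∃ λ t → x ≡ colour G f t
    used (here eq)                                 = u , eq
    used (there (here eq))                         = v , eq
    used (there (there (here eq)))                 = w 0 , eq
    used (there (there (there (here eq))))         = w 1 , eq
    used (there (there (there (there (here eq))))) = w (proj₁ j₃) , eq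

K₂s∨C : (r s : ℕ) → 3 ≤ 1 + 2 * s → Graph
K₂s∨C r s 3≤n = copies r K₂ ∨ cycle (1 + 2 * s) 3≤n

-- The ends of copy `i` of `K₂` serve as the edge, the residues modulo `n` as the odd closed walk.
five≤#colours : ∀ {r} → Fin r → ∀ s 3≤n (f : Labelling (K₂s∨C r s 3≤n)) →
  IsLocalTotalNeighbourhoodAntimagic (K₂s∨C r s 3≤n) f → 5 ≤ #colours (K₂s∨C r s 3≤n) f
five≤#colours {r} i s 3≤n f antimagic = edge∨odd-cycle⇒5≤#colours (K₂s∨C r s 3≤n) f antimagic
  (λ j → inj₂ (j mod n)) s
  (inj₁ (i , zero) , inj₁ refl)
  (λ j → inj₂ (inj₂ ((i , zero) , j mod n)) , inj₁ refl)
  (λ j → inj₂ (inj₂ ((i , suc zero) , j mod n)) , inj₁ refl)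
  (λ j → inj₂ (inj₁ (j mod n)) , inj₁ (cong (λ k → inj₂ (j mod n) , inj₂ k) (suc-mod j n)))
  -- `2 * s` unfolds to `s + (s + 0)`, not to `s + s`.
  (trans (cong (λ k → inj₂ (suc (s + k) mod n)) (sym (ℕ.+-identityʳ s)))
         (cong inj₂ (toℕ-injective {n} (trans (toℕ-fromℕ< (m%n<n n n)) (n%n≡0 n)))))
  where
  n = 1 + 2 * s

-- Colours on `K₂s∨C` in terms of the labels

-- `next` is by definition the second end of an edge in `cycle`. Adding `m` subtracts 1 modulo
-- `suc m`.
next prev : ∀ {m} → Fin (suc m) → Fin (suc m)
next {m} j = suc (toℕ j) mod suc m
prev {m} j = (toℕ j + m) mod suc m

next-prev : ∀ {m} (j : Fin (suc m)) → next (prev j) ≡ j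
next-prev {m} j = trans (suc-mod (toℕ j + m) (suc m)) (toℕ-injective
  (trans (toℕ-fromℕ< (m%n<n (suc (toℕ j + m)) (suc m)))
  (trans (cong (_% suc m) (sym (ℕ.+-suc (toℕ j) m)))
  (trans ([m+n]%n≡m%n (toℕ j) (suc m)) (m<n⇒m%n≡m (toℕ<n j))))))

-- By `next-prev`, `prev` is injective, hence onto a finite type, and its left inverse is two-sided.
prev-next : ∀ {m} (k : Fin (suc m)) → prev (next k) ≡ k
prev-next k
  with k′ , refl ← injective⇒surjective prev
         (λ {i} {j} eq → trans (sym (next-prev i)) (trans (cong next eq) (next-prev j))) k
  = cong prev (next-prev k′)

-- Names as for a wheel: hubs are the ends of the copies of `K₂`, the rim is the cycle, spokes are
-- the edges of the join.
hub : ∀ {r n} → Fin r → Fin 2 → (Fin r × Fin 2) ⊎ Fin n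
hub i p = inj₁ (i , p)

rim : ∀ {r n} → Fin n → (Fin r × Fin 2) ⊎ Fin n
rim = inj₂

hub-edge : ∀ {r n} → Fin r → (Fin r × Fin 1) ⊎ Fin n ⊎ ((Fin r × Fin 2) × Fin n)
hub-edge i = inj₁ (i , zero)

rim-edge : ∀ {r n} → Fin n → (Fin r × Fin 1) ⊎ Fin n ⊎ ((Fin r × Fin 2) × Fin n)
rim-edge j = inj₂ (inj₁ j)

spoke : ∀ {r n} → Fin r → Fin 2 → Fin n → (Fin r × Fin 1) ⊎ Fin n ⊎ ((Fin r × Fin 2) × Fin n)
spoke i p j = inj₂ (inj₂ ((i , p) , j))

module _ (r s : ℕ) (3≤n : 3 ≤ 1 + 2 * s) (f : Labelling (K₂s∨C r s 3≤n)) where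
  private
    G = K₂s∨C r s 3≤n
    open Graph G using (ends-asym)
    n = 1 + 2 * s
    L = label G f

    hub-index : ∀ {i i′ : Fin r} {p p′} → hub {n = n} i p ≡ hub i′ p′ → i ≡ i′
    hub-index eq = ,-injectiveˡ (inj₁-injective eq)

    hub-side : ∀ {i i′ : Fin r} {p p′} → hub {n = n} i p ≡ hub i′ p′ → p ≡ p′
    hub-side eq = ,-injectiveʳ (inj₁-injective eq)

    next≢ : ∀ j → next j ≢ j
    next≢ j eq = ends-asym (rim-edge j) (rim-edge j)
      (cong₂ (λ a b → rim a , rim b) (sym eq) eq)

  -- The edge of its own copy, with far end `opposite p`, and its own spokes are the only edges at
  -- this vertex.
  colour-hub : ∀ i p → colour G f (hub i p) ≡
    (L (inj₂ (hub-edge i)) + L (inj₁ (hub i (opposite p)))) +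
    ∑[ j < n ] (L (inj₂ (spoke i p j)) + L (inj₁ (rim j)))
  colour-hub i p = trans (∑-edges-∨ (copies r K₂) (cycle n 3≤n) contr)
    (cong₂ _+_ own (cong₂ _+_ around spokes))
    where
    contr = contribution G f (hub i p)

    around : _ ≡ 0
    around = ∑-zero (contr ∘ rim-edge) λ j →
      contribution-off G f (hub i p) (rim-edge j) (λ ()) (λ ()) refl

    own-end : ∀ p → contribution G f (hub i p) (hub-edge i) ≡
                    L (inj₂ (hub-edge i)) + L (inj₁ (hub i (opposite p)))
    own-end zero       = contribution-fst G f (hub i zero) (hub-edge i) refl
    own-end (suc zero) = contribution-snd G f (hub i (suc zero)) (hub-edge i) (λ ()) refl

    own : _ ≡ _
    own = trans (∑-edges-copies r K₂ (contr ∘ inj₁))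
         -- The `+ 0` is left over from the sum over the single edge of `K₂`.
         (trans (∑-supp₁ (λ i′ → contr (hub-edge i′) + 0) i λ i′ i′≢i →
             cong (_+ 0) (contribution-off G f (hub i p) (hub-edge i′)
                           (i′≢i ∘ hub-index) (i′≢i ∘ hub-index) refl))
         (trans (ℕ.+-identityʳ _) (own-end p)))

    spokes : _ ≡ _
    spokes = trans (∑-vertices-copies r K₂ (λ v → ∑[ j < n ] contr (inj₂ (inj₂ (v , j)))))
      (trans (∑-supp₁ (λ i′ → ∑[ p′ < 2 ] ∑[ j < n ] contr (spoke i′ p′ j)) i
               λ i′ i′≢i → ∑-zero (λ p′ → ∑[ j < n ] contr (spoke i′ p′ j)) λ p′ →
               ∑-zero (λ j → contr (spoke i′ p′ j)) λ j →
               contribution-off G f (hub i p) (spoke i′ p′ j) (i′≢i ∘ hub-index) (λ ()) refl)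
      (trans (∑-supp₁ (λ p′ → ∑[ j < n ] contr (spoke i p′ j)) p
               λ p′ p′≢p → ∑-zero (λ j → contr (spoke i p′ j)) λ j →
               contribution-off G f (hub i p) (spoke i p′ j) (p′≢p ∘ hub-side) (λ ()) refl)
             (sum-cong-≗ λ j → contribution-fst G f (hub i p) (spoke i p j) refl)))

  -- Vertex `j` is the first end of `rim-edge j`, the second end of `rim-edge (prev j)`, and the
  -- second end of one spoke from each hub.
  colour-rim : ∀ j → colour G f (rim j) ≡
    (L (inj₂ (rim-edge j)) + L (inj₁ (rim (next j))) +
     (L (inj₂ (rim-edge (prev j))) + L (inj₁ (rim (prev j))))) +
    ∑[ i < r ] ∑[ p < 2 ] (L (inj₂ (spoke i p j)) + L (inj₁ (hub i p)))
  colour-rim j = trans (∑-edges-∨ (copies r K₂) (cycle n 3≤n) contr)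
    (cong₂ _+_ own (cong₂ _+_ around spokes))
    where
    contr = contribution G f (rim j)

    own : _ ≡ 0
    own = trans (∑-edges-copies r K₂ (contr ∘ inj₁))
      (∑-zero (λ i → contr (hub-edge i) + 0) λ i →
        cong (_+ 0) (contribution-off G f (rim j) (hub-edge i) (λ ()) (λ ()) refl))

    j≢prev : j ≢ prev j
    j≢prev eq = next≢ j (trans (cong next eq) (next-prev j))

    around : _ ≡ _
    around = trans (∑-supp₂ (contr ∘ rim-edge) j (prev j) j≢prev λ k k≢j k≢prev →
        contribution-off G f (rim j) (rim-edge k) (k≢j ∘ inj₂-injective)
          -- An edge with second end `j` has index `prev j`, because `prev` inverts `next`.
          (λ eq → k≢prev (trans (sym (prev-next k)) (cong prev (inj₂-injective eq)))) refl)
      (cong₂ _+_ (contribution-fst G f (rim j) (rim-edge j) refl)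
                 (contribution-snd G f (rim j) (rim-edge (prev j)) (j≢prev ∘ sym ∘ inj₂-injective)
                   (cong (λ k → rim (prev j) , rim k) (next-prev j))))

    spokes : _ ≡ _
    spokes = trans (∑-vertices-copies r K₂ (λ v → ∑[ k < n ] contr (inj₂ (inj₂ (v , k)))))
      (sum-cong-≗ λ i → sum-cong-≗ λ p →
        trans (∑-supp₁ (contr ∘ spoke i p) j λ k k≢j →
                contribution-off G f (rim j) (spoke i p k) (λ ()) (k≢j ∘ inj₂-injective) refl)
              (contribution-snd G f (rim j) (spoke i p j) (λ ()) refl))

-- Interleaved progressions and the layout of pairs of labels

-- f 0, g 0, f 1, g 1, …
interleave : (f g : ℕ → ℕ) → ℕ → ℕ
interleave f g zero    = f 0
interleave f g (suc k) = interleave g (f ∘ suc) k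

interleave-even : ∀ f g i → interleave f g (i + i) ≡ f i
interleave-even f g zero    = refl
interleave-even f g (suc i) rewrite ℕ.+-suc i i = interleave-even (f ∘ suc) (g ∘ suc) i

interleave-odd : ∀ f g i → interleave f g (suc (i + i)) ≡ g i
interleave-odd f g = interleave-even g (f ∘ suc)

data Parity : ℕ → Set where
  even : ∀ i → Parity (i + i)
  odd  : ∀ i → Parity (suc (i + i))

parity : ∀ k → Parity k
parity zero = even 0
parity (suc k) with parity k
... | even i = odd i
... | odd  i = subst Parity (cong suc (ℕ.+-suc i i)) (even (suc i))

double-< : ∀ {i h} → i < h → i + i < h + h
double-< i<h = ℕ.+-mono-< i<h i<h

halve-< : ∀ {i h} → i + i < h + h → i < h
halve-< {i} {h} lt = ℕ.≰⇒> λ h≤i → ℕ.<⇒≱ lt (ℕ.+-mono-≤ h≤i h≤i)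

∑-interleave-double : ∀ s f g →
  ∑[ j < s + s ] interleave f g (toℕ j) ≡ ∑[ i < s ] (f (toℕ i) + g (toℕ i))
∑-interleave-double zero    f g = refl
∑-interleave-double (suc s) f g rewrite ℕ.+-suc s s =
  trans (sym (ℕ.+-assoc (f 0) (g 0) _))
        (cong (f 0 + g 0 +_) (∑-interleave-double s (f ∘ suc) (g ∘ suc)))

-- The sum is `s * c` plus `s` times `s` minus 1. Here and below, negative terms are moved to the
-- other side to avoid subtraction.
∑-arithmetic : ∀ s c → ∑[ i < s ] (c + 2 * toℕ i) + s ≡ s * c + s * s
∑-arithmetic zero    c = refl
∑-arithmetic (suc s) c = trans
  (cong (λ z → c + 0 + z + suc s) (sum-cong-≗ {s} λ i → shift c (toℕ i)))
  (trans (rearrange c s (∑[ i < s ] (2 + c + 2 * toℕ i)))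
         (trans (cong (λ z → c + 1 + z) (∑-arithmetic s (2 + c))) (collect s c)))
  where
  shift : ∀ c i → c + 2 * suc i ≡ 2 + c + 2 * i
  shift = solve-∀
  rearrange : ∀ c s z → c + 0 + z + suc s ≡ c + 1 + (z + s)
  rearrange = solve-∀
  collect : ∀ s c → c + 1 + (s * (2 + c) + s * s) ≡ suc s * c + suc s * suc s
  collect = solve-∀

-- The first two columns of spokes (A and B) and the rim (X) share 2r + n complementary pairs of
-- labels, each taking two runs of consecutive numbers. Along the order of i, A i + B i must increase by exactly 1; this is a₂+b₂≡1+κ, and it
-- fails for even r if the runs of A and B are contiguous. The runs of X, of lengths s + 1 and s,
-- are therefore inserted between them.
Covers : (r n : ℕ) (A B X : ℕ → ℕ) → ℕ → Set
Covers r n A B X t =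
  (∃ λ (i : Fin r) → A (toℕ i) ≡ t) ⊎
  (∃ λ (i : Fin r) → B (toℕ i) ≡ t) ⊎
  (∃ λ (j : Fin n) → X (toℕ j) ≡ t)

record Layout (r s : ℕ) : Set where
  field
    -- The first six are the starts of the runs. Between the two runs of `X` lie `η` numbers, and
    -- `ω` is the part of the sum of `X` that varies between the layouts.
    a₁ a₂ b₁ b₂ α β η ω : ℕ

  κ : ℕ
  κ = a₁ + b₁

  A : ℕ → ℕ
  A = interleave (a₁ +_) (a₂ +_)

  B : ℕ → ℕ
  B = interleave (b₁ +_) (b₂ +_)

  X : ℕ → ℕ
  X = interleave (α +_) (β +_)

  field
    a₂+b₂≡1+κ : a₂ + b₂ ≡ suc κ
    β-gap     : β ≡ α + suc s + η
    η-pos     : 1 ≤ η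
    η-bound   : η ≤ 2 * r
    ω-def     : (1 + 2 * s) * α + s * η ≡ 2 * (r * s) + ω
    κω-upper  : κ + ω ≤ 2 * r + 2 * s + 1
    κ-lower   : 3 * r + 4 * s + 2 ≤ 2 * κ
    cover     : ∀ t → t < 2 * r + (1 + 2 * s) → Covers r (1 + 2 * s) A B X t

  -- The increase with `i` will be offset by the complement of `i` in the third column of spokes.
  A+B : ∀ i → A i + B i ≡ κ + i
  A+B i with parity i
  ... | even k = trans (cong₂ _+_ (interleave-even _ _ k) (interleave-even _ _ k)) (eq a₁ b₁ k)
    where
    eq : ∀ a b k → a + k + (b + k) ≡ a + b + (k + k)
    eq = solve-∀
  ... | odd k = trans (cong₂ _+_ (interleave-odd (a₁ +_) _ k) (interleave-odd (b₁ +_) _ k))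
      (trans (eq a₂ b₂ k) (trans (cong (_+ (k + k)) a₂+b₂≡1+κ) (sym (ℕ.+-suc κ (k + k)))))
    where
    eq : ∀ a b k → a + k + (b + k) ≡ a + b + (k + k)
    eq = solve-∀

  -- The first term `α` is split off and each later `β + i` is paired with `α + suc i`; `ω-def` then
  -- puts the result in the form common to both layouts.
  ∑X : ∑[ j < 1 + 2 * s ] X (toℕ j) ≡ 2 * (r * s) + ω + (2 * (s * s) + s)
  ∑X = ℕ.+-cancelʳ-≡ s _ _ (begin
    ∑[ j < 1 + 2 * s ] X (toℕ j) + s
      ≡⟨ cong (λ k → ∑[ j < suc (s + k) ] X (toℕ j) + s) (ℕ.+-identityʳ s) ⟩
    α + 0 + ∑[ j < s + s ] X (suc (toℕ j)) + s
      ≡⟨ cong (λ z → α + 0 + z + s) (∑-interleave-double s (β +_) ((α +_) ∘ suc)) ⟩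
    α + 0 + ∑[ i < s ] (β + toℕ i + (α + suc (toℕ i))) + s
      ≡⟨ cong (λ z → α + 0 + z + s) (sum-cong-≗ {s} λ i → eq α β (toℕ i)) ⟩
    α + 0 + ∑[ i < s ] (suc (α + β) + 2 * toℕ i) + s
      ≡⟨ ℕ.+-assoc (α + 0) _ s ⟩
    α + 0 + (∑[ i < s ] (suc (α + β) + 2 * toℕ i) + s)
      ≡⟨ cong (α + 0 +_) (∑-arithmetic s (suc (α + β))) ⟩
    α + 0 + (s * suc (α + β) + s * s)
      ≡⟨ cong (λ z → α + 0 + (s * suc (α + z) + s * s)) β-gap ⟩
    α + 0 + (s * suc (α + (α + suc s + η)) + s * s)
      ≡⟨ collect α s η ⟩
    (1 + 2 * s) * α + s * η + (2 * (s * s) + s + s)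
      ≡⟨ cong (_+ (2 * (s * s) + s + s)) ω-def ⟩
    2 * (r * s) + ω + (2 * (s * s) + s + s)
      ≡⟨ ℕ.+-assoc (2 * (r * s) + ω) (2 * (s * s) + s) s ⟨
    2 * (r * s) + ω + (2 * (s * s) + s) + s ∎)
    where
    eq : ∀ a b i → b + i + (a + suc i) ≡ suc (a + b) + 2 * i
    eq = solve-∀
    collect : ∀ a s e → a + 0 + (s * suc (a + (a + suc s + e)) + s * s) ≡
              (1 + 2 * s) * a + s * e + (2 * (s * s) + s + s)
    collect = solve-∀

-- Peels the first `m` numbers off a range; nested uses run through consecutive blocks.
interval : ∀ (P : ℕ → Set) o m {e} → (∀ i → i < m → P (o + i)) →
           (∀ t → o + m ≤ t → t < e → P t) → ∀ t → o ≤ t → t < e → P t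
interval P o m inside above t o≤t t<e with t ℕ.<? o + m
... | yes t<o+m = subst P (ℕ.m+[n∸m]≡n o≤t)
      (inside (t ∸ o) (ℕ.+-cancelˡ-< o _ _ (subst (_< o + m) (sym (ℕ.m+[n∸m]≡n o≤t)) t<o+m)))
... | no  t≮o+m = above t (ℕ.≮⇒≥ t≮o+m) t<e

interleave-even-< : ∀ {n f g} i → i + i < n → ∃ λ (j : Fin n) → interleave f g (toℕ j) ≡ f i
interleave-even-< {n} {f} {g} i lt = fromℕ< lt ,
  trans (cong (interleave f g) (toℕ-fromℕ< lt)) (interleave-even f g i)

interleave-odd-< : ∀ {n f g} i → suc (i + i) < n → ∃ λ (j : Fin n) → interleave f g (toℕ j) ≡ g i
interleave-odd-< {n} {f} {g} i lt = fromℕ< lt ,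
  trans (cong (interleave f g) (toℕ-fromℕ< lt)) (interleave-odd f g i)

suc-double-< : ∀ {i h} → i < h → suc (i + i) < h + h
suc-double-< {i} {suc h} (s≤s i≤h) =
  s≤s (subst (suc (i + i) ≤_) (sym (ℕ.+-suc h h)) (s≤s (ℕ.+-mono-≤ i≤h i≤h)))

double-<-1+2* : ∀ {i s} → i < suc s → i + i < 1 + 2 * s
double-<-1+2* {i} {s} (s≤s i≤s) = s≤s (ℕ.+-mono-≤ i≤s (ℕ.≤-trans i≤s (ℕ.m≤m+n s 0)))

suc-double-<-1+2* : ∀ {i s} → i < s → suc (i + i) < 1 + 2 * s
suc-double-<-1+2* {i} {s} i<s = s≤s (ℕ.+-mono-<-≤ i<s (ℕ.≤-trans (ℕ.<⇒≤ i<s) (ℕ.m≤m+n s 0)))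

-- Runs from the bottom, by parity of the index: `A` even, `X` even, `A` odd, `B` odd, `X` odd, `B`
-- even.
layout-even : ∀ h s → 1 ≤ h → Layout (h + h) s
layout-even h s 1≤h = record
  { a₁ = 0 ; α = h ; a₂ = a₂ ; b₂ = b₂ ; β = β ; b₁ = b₁ ; η = h + h ; ω = h
  ; a₂+b₂≡1+κ = eq₁ h s
  ; β-gap = eq₂ h s
  ; η-pos = ℕ.≤-trans 1≤h (ℕ.m≤m+n h h)
  ; η-bound = ℕ.m≤m+n (h + h) _
  ; ω-def = eq₃ h s
  ; κω-upper = ℕ.≤-reflexive (eq₄ h s)
  ; κ-lower = ℕ.≤-reflexive (eq₅ h s)
  ; cover = λ t t<e →
      interval P 0 h (λ i i<h → inj₁ (interleave-even-< i (double-< i<h)))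
     (interval P h (suc s) (λ i i≤s → inj₂ (inj₂ (interleave-even-< i (double-<-1+2* i≤s))))
     (interval P a₂ h (λ i i<h → inj₁ (interleave-odd-< i (suc-double-< i<h)))
     (interval P b₂ h (λ i i<h → inj₂ (inj₁ (interleave-odd-< i (suc-double-< i<h))))
     (interval P β s (λ i i<s → inj₂ (inj₂ (interleave-odd-< i (suc-double-<-1+2* i<s))))
     (interval P b₁ h (λ i i<h → inj₂ (inj₁ (interleave-even-< i (double-< i<h))))
      (λ t e≤t t<e → contradiction
        (ℕ.<-≤-trans t<e (ℕ.≤-trans (ℕ.≤-reflexive (eq₆ h s)) e≤t)) (ℕ.<-irrefl refl)))))))
      t z≤n t<e
  }
  where
  a₂ = h + suc s
  b₂ = a₂ + h
  β  = b₂ + h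
  b₁ = β + s
  P = Covers (h + h) (1 + 2 * s)
        (interleave (0 +_) (a₂ +_)) (interleave (b₁ +_) (b₂ +_)) (interleave (h +_) (β +_))
  eq₁ : ∀ h s → h + suc s + (h + suc s + h) ≡ suc (0 + (h + suc s + h + h + s))
  eq₁ = solve-∀
  eq₂ : ∀ h s → h + suc s + h + h ≡ h + suc s + (h + h)
  eq₂ = solve-∀
  eq₃ : ∀ h s → (1 + 2 * s) * h + s * (h + h) ≡ 2 * ((h + h) * s) + h
  eq₃ = solve-∀
  eq₄ : ∀ h s → 0 + (h + suc s + h + h + s) + h ≡ 2 * (h + h) + 2 * s + 1
  eq₄ = solve-∀
  eq₅ : ∀ h s → 3 * (h + h) + 4 * s + 2 ≡ 2 * (0 + (h + suc s + h + h + s))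
  eq₅ = solve-∀
  eq₆ : ∀ h s → 2 * (h + h) + (1 + 2 * s) ≡ h + suc s + h + h + s + h
  eq₆ = solve-∀

-- Here the four runs of `A` and `B` are contiguous. From the bottom: `X` even, `A` even, `A` odd,
-- `B` odd, `B` even, `X` odd.
layout-odd : ∀ h s → Layout (suc (h + h)) s
layout-odd h s = record
  { α = 0 ; a₁ = suc s ; a₂ = a₂ ; b₂ = b₂ ; b₁ = b₁ ; β = β ; η = 2 * suc (h + h) ; ω = 0
  ; a₂+b₂≡1+κ = eq₁ h s
  ; β-gap = eq₂ h s
  ; η-pos = s≤s z≤n
  ; η-bound = ℕ.≤-refl
  ; ω-def = eq₃ h s
  ; κω-upper = ℕ.≤-trans (ℕ.m≤m+n _ h) (ℕ.≤-reflexive (eq₄ h s))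
  ; κ-lower = ℕ.≤-trans (ℕ.m≤m+n _ 1) (ℕ.≤-reflexive (eq₅ h s))
  ; cover = λ t t<e →
      interval P 0 (suc s) (λ i i≤s → inj₂ (inj₂ (interleave-even-< i (double-<-1+2* i≤s))))
     (interval P (suc s) (suc h) (λ i i≤h → inj₁ (interleave-even-< i (row-even i≤h)))
     (interval P a₂ h (λ i i<h → inj₁ (interleave-odd-< i (s≤s (double-< i<h))))
     (interval P b₂ h (λ i i<h → inj₂ (inj₁ (interleave-odd-< i (s≤s (double-< i<h)))))
     (interval P b₁ (suc h) (λ i i≤h → inj₂ (inj₁ (interleave-even-< i (row-even i≤h))))
     (interval P β s (λ i i<s → inj₂ (inj₂ (interleave-odd-< i (suc-double-<-1+2* i<s))))
      (λ t e≤t t<e → contradiction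
        (ℕ.<-≤-trans t<e (ℕ.≤-trans (ℕ.≤-reflexive (eq₆ h s)) e≤t)) (ℕ.<-irrefl refl)))))))
      t z≤n t<e
  }
  where
  a₂ = suc s + suc h
  b₂ = a₂ + h
  b₁ = b₂ + h
  β  = b₁ + suc h
  row-even : ∀ {i} → i < suc h → i + i < suc (h + h)
  row-even (s≤s i≤h) = s≤s (ℕ.+-mono-≤ i≤h i≤h)
  P = Covers (suc (h + h)) (1 + 2 * s)
        (interleave (suc s +_) (a₂ +_)) (interleave (b₁ +_) (b₂ +_)) (interleave (0 +_) (β +_))
  eq₁ : ∀ h s → suc s + suc h + (suc s + suc h + h) ≡ suc (suc s + (suc s + suc h + h + h))
  eq₁ = solve-∀
  eq₂ : ∀ h s → suc s + suc h + h + h + suc h ≡ 0 + suc s + 2 * suc (h + h)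
  eq₂ = solve-∀
  eq₃ : ∀ h s → (1 + 2 * s) * 0 + s * (2 * suc (h + h)) ≡ 2 * (suc (h + h) * s) + 0
  eq₃ = solve-∀
  eq₄ : ∀ h s → suc s + (suc s + suc h + h + h) + 0 + h ≡ 2 * suc (h + h) + 2 * s + 1
  eq₄ = solve-∀
  eq₅ : ∀ h s → 3 * suc (h + h) + 4 * s + 2 + 1 ≡ 2 * (suc s + (suc s + suc h + h + h))
  eq₅ = solve-∀
  eq₆ : ∀ h s → 2 * suc (h + h) + (1 + 2 * s) ≡ suc s + suc h + h + h + suc h + s
  eq₆ = solve-∀

layout : ∀ r s → 1 ≤ r → Layout r s
layout r s 1≤r with parity r
... | odd h        = layout-odd h s
... | even (suc h) = layout-even (suc h) s (s≤s z≤n)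

-- Inequalities between the colours

-- Here and below s = t + 1.
module Arithmetic (r t : ℕ) where
  -- The labels form `T` complementary pairs around `3 * r` middle labels. The first `base` pairs
  -- belong to the last `1 + 2 * t` columns of spokes, with `r` pairs in each.
  s n base T N W : ℕ
  s    = suc t
  n    = 1 + 2 * s
  base = (1 + 2 * t) * r
  T    = base + (2 * r + n)
  N    = 2 * T + 3 * r
  W    = (2 + 2 * r) * suc N

  -- Sums of labels: `M κ` is that of the spokes at `hub i zero`, increased by `t * r`; `x̄ ω` is
  -- that of the cycle vertices.
  M x̄ : ℕ → ℕ
  M κ = 2 + 2 * base + κ + N + t * suc N
  x̄ ω = n * suc base + (2 * (r * s) + ω + (2 * (s * s) + s))

-- The smallest rim colour is `W` minus `s + η`. With `r = s + k` and the bounds on `κ + ω` and `η`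
-- inserted, the sides are polynomials in `t` and `k`.
low-bound : ∀ {r t κ ω η u} → let open Arithmetic r t in
  suc t ≤ r → κ + ω ≤ 2 * r + 2 * s + 1 → η ≤ 2 * r →
  u + t * r ≡ suc (N + r) + M κ + x̄ ω → u + (s + η) < W
low-bound {r} {t} {κ} {ω} {η} {u} s≤r κω η≤ u≡ with k , refl ← ℕ.m≤n⇒∃[o]m+o≡n s≤r =
  ℕ.+-cancelʳ-≤ (t * r) _ _ (ℕ.≤-trans (ℕ.≤-reflexive (cong suc (begin
    u + (s + η) + t * r                      ≡⟨ eq₁ u (s + η) (t * r) ⟩
    u + t * r + (s + η)                      ≡⟨ cong (_+ (s + η)) u≡ ⟩
    suc (N + r) + M κ + x̄ ω + (s + η)
      ≡⟨ eq₂ (suc (N + r)) (2 + 2 * base) κ N (t * suc N)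
             (n * suc base) (2 * (r * s)) ω (2 * (s * s) + s) s η ⟩
    suc (N + r) + M 0 + x̄ 0 + s + (κ + ω) + η ∎)))
  (ℕ.≤-trans (s≤s (ℕ.+-mono-≤ (ℕ.+-monoʳ-≤ (suc (N + r) + M 0 + x̄ 0 + s) κω) η≤))
  (ℕ.≤-trans (ℕ.m≤m+n _ _) (ℕ.≤-reflexive (eq₃ t k)))))
  where
  open Arithmetic r t
  eq₁ : ∀ a b c → a + b + c ≡ a + c + b
  eq₁ = solve-∀
  eq₂ : ∀ a b k N w x y o z s e → a + (b + k + N + w) + (x + (y + o + z)) + (s + e) ≡
                                  a + (b + 0 + N + w) + (x + (y + 0 + z)) + s + (k + o) + e
  eq₂ = solve-∀
  -- The cubic is the difference of the two sides; only its nonnegative coefficients matter.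
  eq₃ : ∀ t k → let s = suc t; r = s + k; b = (1 + 2 * t) * r; n = 1 + 2 * s
                    N = 2 * (b + (2 * r + n)) + 3 * r in
    suc (suc (N + r) + (2 + 2 * b + 0 + N + t * suc N) +
         (n * suc b + (2 * (r * s) + 0 + (2 * (s * s) + s))) + s + (2 * r + 2 * s + 1) + 2 * r) +
    (8 + 38 * k + 18 * (k * k) + 15 * t + 38 * (t * k) + 8 * (t * (k * k)) + 6 * (t * t) +
     8 * (t * (t * k)))
    ≡ (2 + 2 * r) * suc N + t * r
  eq₃ = solve-∀

-- The largest rim colour is `W + (suc s + η)`. With `r = suc r′` and `t = r + k` this is again a
-- comparison of coefficients; `κ` is bounded through `κ + ω`, and `ω` is dropped from the larger
-- side.
high-bound : ∀ {r t κ ω η v} → let open Arithmetic r t in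
  1 ≤ r → r ≤ t → κ + ω ≤ 2 * r + 2 * s + 1 → η ≤ 2 * r →
  v + (r + M κ) ≡ suc N + x̄ ω + n * suc N + t * r → W + (suc s + η) < v
high-bound {suc r′} {t} {κ} {ω} {η} {v} _ r≤t κω η≤ v≡ with k , refl ← ℕ.m≤n⇒∃[o]m+o≡n r≤t =
  ℕ.+-cancelʳ-≤ (r + M κ) _ _
  (ℕ.≤-trans (ℕ.≤-reflexive (eq₁ W s η r (2 + 2 * base) κ N (t * suc N)))
  (ℕ.≤-trans (s≤s (ℕ.+-mono-≤
    (ℕ.+-monoʳ-≤ (W + suc s + (r + M 0)) (ℕ.≤-trans (ℕ.m≤m+n κ ω) κω)) η≤))
  (ℕ.≤-trans (ℕ.m≤m+n _ _) (ℕ.≤-trans (ℕ.≤-reflexive (eq₃ r′ k))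
  (ℕ.≤-trans (ℕ.m≤m+n _ ω) (ℕ.≤-reflexive (trans
    (eq₂ (suc N) (n * suc base) (2 * (r * s)) (2 * (s * s) + s) (n * suc N) (t * r) ω)
    (sym v≡))))))))
  where
  r = suc r′
  open Arithmetic r t
  eq₁ : ∀ W s η r b κ N w → suc (W + (suc s + η)) + (r + (b + κ + N + w)) ≡
                            suc (W + suc s + (r + (b + 0 + N + w)) + κ + η)
  eq₁ = solve-∀
  eq₂ : ∀ K x y z m w o → K + (x + (y + 0 + z)) + m + w + o ≡ K + (x + (y + o + z)) + m + w
  eq₂ = solve-∀
  eq₃ : ∀ r′ k → let r = suc r′; t = r + k; s = suc t; b = (1 + 2 * t) * r; n = 1 + 2 * s
                     N = 2 * (b + (2 * r + n)) + 3 * r in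
    suc ((2 + 2 * r) * suc N + suc s + (r + (2 + 2 * b + 0 + N + t * suc N)) +
         (2 * r + 2 * s + 1) + 2 * r) +
    (14 + 47 * k + 14 * (k * k) + 8 * r′ + 40 * (r′ * k) + 8 * (r′ * (k * k)) +
     8 * (r′ * (r′ * k)))
    ≡ suc N + (n * suc b + (2 * (r * s) + 0 + (2 * (s * s) + s))) + n * suc N + t * r
  eq₃ = solve-∀

-- In the difference of the two equations `x̄ ω` cancels: `u` minus `v` is `2 * κ + 2 * (r * t)`
-- minus `3 * r + 4 * s + 1`.
high<low : ∀ {r t κ ω u v} → let open Arithmetic r t in
  3 * r + 4 * s + 2 ≤ 2 * κ →
  u + t * r ≡ suc (N + r) + M κ + x̄ ω → v + (r + M κ) ≡ suc N + x̄ ω + n * suc N + t * r → v < u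
high<low {r} {t} {κ} {ω} {u} {v} κ≥ u≡ v≡ =
  ℕ.+-cancelʳ-≤ (r + M κ + t * r) _ _ (ℕ.≤-trans (ℕ.≤-reflexive (begin
    suc v + (r + M κ + t * r)                       ≡⟨ cong suc (ℕ.+-assoc v (r + M κ) (t * r)) ⟨
    suc (v + (r + M κ) + t * r)                     ≡⟨ cong (λ z → suc (z + t * r)) v≡ ⟩
    suc (suc N + x̄ ω + n * suc N + t * r + t * r)   ∎))
  (ℕ.+-cancelʳ-≤ (3 * r + 4 * s + 2) _ _
  (ℕ.≤-trans (ℕ.+-monoʳ-≤ (suc (suc N + x̄ ω + n * suc N + t * r + t * r)) κ≥)
  (ℕ.≤-trans (ℕ.m≤m+n _ (2 * (r * t)))
  (ℕ.≤-reflexive (trans (eq₁ r t κ (x̄ ω)) (cong (_+ (3 * r + 4 * s + 2)) (begin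
    suc (N + r) + M κ + x̄ ω + (r + M κ)             ≡⟨ cong (_+ (r + M κ)) u≡ ⟨
    u + t * r + (r + M κ)                           ≡⟨ eq₂ u (t * r) (r + M κ) ⟩
    u + (r + M κ + t * r) ∎))))))))
  where
  open Arithmetic r t
  eq₁ : ∀ r t κ x → let s = suc t; b = (1 + 2 * t) * r; n = 1 + 2 * s
                        N = 2 * (b + (2 * r + n)) + 3 * r; M = 2 + 2 * b + κ + N + t * suc N in
    suc (suc N + x + n * suc N + t * r + t * r) + 2 * κ + 2 * (r * t)
    ≡ suc (N + r) + M + x + (r + M) + (3 * r + 4 * s + 2)
  eq₁ = solve-∀
  eq₂ : ∀ u w m → u + w + m ≡ u + (m + w)
  eq₂ = solve-∀

-- Comparison of the colours

module _ (r t : ℕ) .{{_ : NonZero r}} (lay : Layout r (suc t)) where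
  open Layout lay
  open Arithmetic r t

  -- The colours of the two kinds of hubs and of the rim enter only through three equations, which
  -- keeps the labelling itself out of the comparisons.
  module Colours
    (u v : Fin r → ℕ) (c : Fin n → ℕ)
    (u≡ : ∀ i → u i + t * r ≡ suc (N + r) + M κ + x̄ ω)
    (v≡ : ∀ i → v i + (r + M κ) ≡ suc N + x̄ ω + n * suc N + t * r)
    (step : ∀ j → c j + X (toℕ j) ≡ X (toℕ (next j)) + W) where

    toℕ-next : ∀ (j : Fin n) {k} → toℕ j ≡ k → suc k < n → toℕ (next j) ≡ suc k
    toℕ-next j refl k<n = trans (toℕ-fromℕ< (m%n<n (suc (toℕ j)) n)) (m<n⇒m%n≡m k<n)

    toℕ-next-last : ∀ (j : Fin n) → toℕ j ≡ s + s → toℕ (next j) ≡ 0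
    toℕ-next-last j eq = trans (toℕ-fromℕ< (m%n<n (suc (toℕ j)) n))
      (trans (cong (λ k → suc k % n) (trans eq (cong (s +_) (sym (ℕ.+-identityʳ s))))) (n%n≡0 n))

    colour-even : ∀ j {i} → toℕ j ≡ i + i → i < s → c j ≡ W + (suc s + η)
    colour-even j {i} j≡ i<s = ℕ.+-cancelʳ-≡ (α + i) _ _ (begin
      c j + (α + i)
        ≡⟨ cong (c j +_) (trans (cong X j≡) (interleave-even (α +_) (β +_) i)) ⟨
      c j + X (toℕ j)
        ≡⟨ step j ⟩
      X (toℕ (next j)) + W
        ≡⟨ cong (_+ W) (trans (cong X (toℕ-next j j≡ (suc-double-<-1+2* i<s)))
                              (interleave-odd (α +_) (β +_) i)) ⟩
      β + i + W
        ≡⟨ cong (λ b → b + i + W) β-gap ⟩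
      α + suc s + η + i + W
        ≡⟨ eq α s η i W ⟩
      W + (suc s + η) + (α + i) ∎)
      where
      eq : ∀ a s e i W → a + suc s + e + i + W ≡ W + (suc s + e) + (a + i)
      eq = solve-∀

    next-odd : ∀ j {i} → toℕ j ≡ suc (i + i) → i < s → toℕ (next j) ≡ suc i + suc i
    next-odd j {i} j≡ i<s =
      trans (toℕ-next j j≡ (subst (_< n) (cong suc (ℕ.+-suc i i)) (double-<-1+2* (s≤s i<s))))
            (sym (cong suc (ℕ.+-suc i i)))

    colour-odd : ∀ j {i} → toℕ j ≡ suc (i + i) → i < s → c j + (s + η) ≡ W
    colour-odd j {i} j≡ i<s = ℕ.+-cancelʳ-≡ (α + suc i) _ _ (begin
      c j + (s + η) + (α + suc i)
        ≡⟨ eq (c j) s η α i ⟩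
      c j + (α + suc s + η + i)
        ≡⟨ cong (λ b → c j + (b + i)) β-gap ⟨
      c j + (β + i)
        ≡⟨ cong (c j +_) (trans (cong X j≡) (interleave-odd (α +_) (β +_) i)) ⟨
      c j + X (toℕ j)
        ≡⟨ step j ⟩
      X (toℕ (next j)) + W
        ≡⟨ cong (_+ W) (trans (cong X (next-odd j j≡ i<s))
                              (interleave-even (α +_) (β +_) (suc i))) ⟩
      α + suc i + W
        ≡⟨ ℕ.+-comm (α + suc i) W ⟩
      W + (α + suc i) ∎)
      where
      eq : ∀ c s e a i → c + (s + e) + (a + suc i) ≡ c + (a + suc s + e + i)
      eq = solve-∀

    -- The last vertex is followed by vertex 0, where `X` falls from `α + s` back to `α`.
    colour-last : ∀ j → toℕ j ≡ s + s → c j + s ≡ W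
    colour-last j j≡ = ℕ.+-cancelʳ-≡ α _ _ (begin
      c j + s + α
        ≡⟨ eq (c j) s α ⟩
      c j + (α + s)
        ≡⟨ cong (c j +_) (trans (cong X j≡) (interleave-even (α +_) (β +_) s)) ⟨
      c j + X (toℕ j)
        ≡⟨ step j ⟩
      X (toℕ (next j)) + W
        ≡⟨ cong (λ k → X k + W) (toℕ-next-last j j≡) ⟩
      α + 0 + W
        ≡⟨ eq′ α W ⟩
      W + α ∎)
      where
      eq : ∀ c s a → c + s + a ≡ c + (a + s)
      eq = solve-∀
      eq′ : ∀ a W → a + 0 + W ≡ W + a
      eq′ = solve-∀

    data Position (k : ℕ) : Set where
      at-even : ∀ i → i < s → k ≡ i + i → Position k
      at-odd  : ∀ i → i < s → k ≡ suc (i + i) → Position k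
      at-last : k ≡ s + s → Position k

    position : ∀ (j : Fin n) → Position (toℕ j)
    position j = go refl (toℕ<n j)
      where
      n≡ : n ≡ suc (s + s)
      n≡ = cong (λ k → suc (s + k)) (ℕ.+-identityʳ s)
      go : ∀ {k} → toℕ j ≡ k → k < n → Position k
      go {k} _ k<n with parity k
      go _ k<n | odd i = at-odd i (halve-< (s≤s⁻¹ (subst (suc (i + i) <_) n≡ k<n))) refl
      go _ k<n | even i with i ℕ.<? s
      ... | yes i<s = at-even i i<s refl
      ... | no  i≮s = at-last (ℕ.≤-antisym (s≤s⁻¹ (subst (i + i <_) n≡ k<n))
                                            (ℕ.+-mono-≤ (ℕ.≮⇒≥ i≮s) (ℕ.≮⇒≥ i≮s)))

    rim-lower : ∀ j → W ≤ c j + (s + η)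
    rim-lower j with position j
    ... | at-even i i<s j≡ = ℕ.≤-trans (ℕ.m≤m+n W _)
            (ℕ.≤-trans (ℕ.≤-reflexive (sym (colour-even j j≡ i<s))) (ℕ.m≤m+n _ _))
    ... | at-odd i i<s j≡  = ℕ.≤-reflexive (sym (colour-odd j j≡ i<s))
    ... | at-last j≡       = ℕ.≤-trans (ℕ.≤-reflexive (sym (colour-last j j≡)))
            (ℕ.+-monoʳ-≤ _ (ℕ.m≤m+n s η))

    rim-upper : ∀ j → c j ≤ W + (suc s + η)
    rim-upper j with position j
    ... | at-even i i<s j≡ = ℕ.≤-reflexive (colour-even j j≡ i<s)
    ... | at-odd i i<s j≡  = ℕ.≤-trans (ℕ.m≤m+n _ _)
            (ℕ.≤-trans (ℕ.≤-reflexive (colour-odd j j≡ i<s)) (ℕ.m≤m+n W _))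
    ... | at-last j≡       = ℕ.≤-trans (ℕ.m≤m+n _ _)
            (ℕ.≤-trans (ℕ.≤-reflexive (colour-last j j≡)) (ℕ.m≤m+n W _))

    -- Even positions other than the last have colours above `W`, all others at most `W`.
    even-clash : ∀ {x y z} → x ≡ W + suc y → x + z ≢ W
    even-clash {x} {y} {z} x≡ x+z≡ =
      ℕ.m+1+n≢m W (trans (sym (ℕ.+-assoc W (suc y) z)) (trans (cong (_+ z) (sym x≡)) x+z≡))

    -- The two colours below `W` are `η` apart, and `η` is positive.
    odd-clash : ∀ {x} → x + (s + η) ≡ W → x + s ≢ W
    odd-clash {x} x≡ x≡′ = ℕ.<⇒≢ (ℕ.+-monoʳ-< x (ℕ.m<m+n s η-pos)) (trans x≡′ (sym x≡))

    rim-proper : ∀ j → c j ≢ c (next j)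
    rim-proper j same with position j
    ... | at-even i i<s j≡ = even-clash (trans (sym same) (colour-even j j≡ i<s))
                               (colour-odd (next j) (toℕ-next j j≡ (suc-double-<-1+2* i<s)) i<s)
    ... | at-last j≡ = even-clash (colour-even (next j) {0} (toℕ-next-last j j≡) (s≤s z≤n))
                         (trans (cong (_+ s) (sym same)) (colour-last j j≡))
    -- The successor of the last odd position is the last vertex; that of any other is an even
    -- position before it.
    ... | at-odd i i<s j≡ with ℕ.m≤n⇒m<n∨m≡n i<s
    ...   | inj₁ 1+i<s = even-clash (trans same (colour-even (next j) (next-odd j j≡ i<s) 1+i<s))
                           (colour-odd j j≡ i<s)
    ...   | inj₂ 1+i≡s = odd-clash (colour-odd j j≡ i<s) (trans (cong (_+ s) same)
                           (colour-last (next j) (trans (next-odd j j≡ i<s) (cong₂ _+_ 1+i≡s 1+i≡s))))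

    low-below-rim : s ≤ r → ∀ i j → u i < c j
    low-below-rim s≤r i j = ℕ.+-cancelʳ-< (s + η) _ _
      (ℕ.<-≤-trans (low-bound {r} {t} {κ} {ω} {η} s≤r κω-upper η-bound (u≡ i)) (rim-lower j))

    rim-below-high : r ≤ t → ∀ i j → c j < v i
    rim-below-high r≤t i j =
      ℕ.≤-<-trans (rim-upper j)
        (high-bound {r} {t} {κ} {ω} {η} (>-nonZero⁻¹ r) r≤t κω-upper η-bound (v≡ i))

    -- The ends `hub i zero` have the lower labels of the two, but the higher colours.
    high-below-low : ∀ i i′ → v i < u i′
    high-below-low i i′ = high<low {r} {t} {κ} {ω} κ-lower (u≡ i′) (v≡ i)

    -- For `s ≤ r` the order is high, low, rim; otherwise it is rim, high, low.
    low≢rim : ∀ i j → u i ≢ c j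
    low≢rim i j with s ℕ.≤? r
    ... | yes s≤r = ℕ.<⇒≢ (low-below-rim s≤r i j)
    ... | no  s≰r =
      ℕ.<⇒≢ (ℕ.<-trans (rim-below-high (s≤s⁻¹ (ℕ.≰⇒> s≰r)) i j) (high-below-low i i)) ∘ sym

    high≢rim : ∀ i j → v i ≢ c j
    high≢rim i j with s ℕ.≤? r
    ... | yes s≤r = ℕ.<⇒≢ (ℕ.<-trans (high-below-low i i) (low-below-rim s≤r i j))
    ... | no  s≰r = ℕ.<⇒≢ (rim-below-high (s≤s⁻¹ (ℕ.≰⇒> s≰r)) i j) ∘ sym

    colours : List ℕ
    colours = (suc (N + r) + M κ + x̄ ω ∸ t * r) ∷
              (suc N + x̄ ω + n * suc N + t * r ∸ (r + M κ)) ∷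
              W + (suc s + η) ∷ (W ∸ (s + η)) ∷ (W ∸ s) ∷ []

    +≡⇒≡∸ : ∀ {a b c} → a + b ≡ c → a ≡ c ∸ b
    +≡⇒≡∸ {a} {b} refl = sym (ℕ.m+n∸n≡m a b)

    low-listed : ∀ i → u i ∈ colours
    low-listed i = here (+≡⇒≡∸ (u≡ i))

    high-listed : ∀ i → v i ∈ colours
    high-listed i = there (here (+≡⇒≡∸ (v≡ i)))

    rim-listed : ∀ j → c j ∈ colours
    rim-listed j with position j
    ... | at-even _ i<s j≡ = there (there (here (colour-even j j≡ i<s)))
    ... | at-odd  _ i<s j≡ = there (there (there (here (+≡⇒≡∸ (colour-odd j j≡ i<s)))))
    ... | at-last j≡       = there (there (there (there (here (+≡⇒≡∸ (colour-last j j≡))))))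

-- The labelling

module Construction (r t : ℕ) .{{_ : NonZero r}} (lay : Layout r (suc t))
                    (3≤n : 3 ≤ 1 + 2 * suc t) where
  open Layout lay
  open Arithmetic r t

  G : Graph
  G = K₂s∨C r s 3≤n

  open Graph G using (ends; V; E; V-finite; E-finite; order; size)

  -- Labels are 0-based: x and N ∸ suc x are complementary.
  pair : Fin 2 → ℕ → ℕ
  pair zero       x = x
  pair (suc zero) x = N ∸ suc x

  -- Alternating between x + l r and the complement makes the sum of two neighbouring columns
  -- independent of x.
  zig : Fin 2 → ℕ → ℕ → ℕ
  zig q x zero    = pair q x
  zig q x (suc l) = zig (opposite q) (x + r) l

  -- Column `2 + l` uses the pair `i + l * r`. From the third column on, the alternation starts with
  -- the side opposite to that of the first two.
  spokes : ℕ → Fin 2 → ℕ → ℕ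
  spokes i p 0             = pair p (base + A i)
  spokes i p 1             = pair p (base + B i)
  spokes i p (suc (suc l)) = zig (opposite p) i l

  -- The edge of copy `i` of `K₂` gets `T + 2 * r` minus `suc i`, decreasing in `i` while its ends
  -- increase. Hence the three kinds fill consecutive blocks of length `r`, and edge plus end is
  -- constant.
  F : V ⊎ E → ℕ
  F (inj₁ (inj₁ (i , zero)))           = T + toℕ i
  F (inj₁ (inj₁ (i , suc zero)))       = T + (2 * r + toℕ i)
  F (inj₁ (inj₂ j))                    = base + X (toℕ j)
  F (inj₂ (inj₁ (i , _)))              = pair (suc zero) (T + (r + toℕ i))
  F (inj₂ (inj₂ (inj₁ j)))             = pair (suc zero) (base + X (toℕ j))
  F (inj₂ (inj₂ (inj₂ ((i , p) , j)))) = spokes (toℕ i) p (toℕ j)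

  -- The row holding side `q` of the pair changes with each column, so it is found by recursion.
  zig-hit : ∀ l q x → ∃ λ p → zig p x l ≡ pair q (x + l * r)
  zig-hit zero    q x = q , cong (pair q) (sym (ℕ.+-identityʳ x))
  zig-hit (suc l) q x with p , eq ← zig-hit l q (x + r) = opposite p ,
    trans (cong (λ p′ → zig p′ (x + r) l) (opp p))
          (trans eq (cong (pair q) (ℕ.+-assoc x r (l * r))))
    where
    opp : ∀ (p : Fin 2) → opposite (opposite p) ≡ p
    opp zero       = refl
    opp (suc zero) = refl

  spokes-hit : ∀ l q i → ∃ λ p → spokes i p (2 + l) ≡ pair q (i + l * r)
  spokes-hit l q i with zig-hit l q i
  ... | zero     , eq = suc zero , eq
  ... | suc zero , eq = zero , eq

  -- Below `base`, division by `r` gives the copy as remainder and the column as quotient; above,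
  -- `cover` tells which of `A`, `B` and `X` takes the pair.
  hit-pair : ∀ q x → x < T → ∃ λ y → F y ≡ pair q x
  hit-pair q x x<T with x ℕ.<? base
  ... | yes x<base with p , eq ← spokes-hit (x / r) q (x % r) =
    inj₂ (spoke (fromℕ< i<r) p (fromℕ< j<n)) ,
    trans (cong₂ (λ i j → spokes i p j) (toℕ-fromℕ< i<r) (toℕ-fromℕ< j<n))
          (trans eq (cong (pair q) (sym (m≡m%n+[m/n]*n x r))))
    where
    i<r : x % r < r
    i<r = m%n<n x r
    three : ∀ t → 2 + (1 + 2 * t) ≡ 1 + 2 * suc t
    three = solve-∀
    j<n : 2 + x / r < n
    j<n = subst (2 + x / r <_) (three t) (s≤s (s≤s (m<n*o⇒m/o<n x<base)))
  ... | no x≮base = locate (cover (x ∸ base) (ℕ.+-cancelˡ-< base _ _ (subst (_< T) (sym x≡) x<T)))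
    where
    x≡ : base + (x ∸ base) ≡ x
    x≡ = ℕ.m+[n∸m]≡n (ℕ.≮⇒≥ x≮base)
    place : ∀ {z} → z ≡ x ∸ base → pair q (base + z) ≡ pair q x
    place refl = cong (pair q) x≡
    locate : Covers r n A B X (x ∸ base) → ∃ λ y → F y ≡ pair q x
    locate (inj₁ (i , eq))        = inj₂ (spoke i q zero) , place eq
    locate (inj₂ (inj₁ (i , eq))) = inj₂ (spoke i q (suc zero)) , place eq
    locate (inj₂ (inj₂ (j , eq))) = rim-hit q refl
      where
      rim-hit : ∀ q′ → q′ ≡ q → ∃ λ y → F y ≡ pair q x
      rim-hit zero       refl = inj₁ (rim j) , place eq
      rim-hit (suc zero) refl = inj₂ (rim-edge j) , place eq

  -- From the bottom: lower halves of the pairs, one end of each `K₂`, the edges, the other ends,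
  -- upper halves of the pairs.
  hit : ∀ l → l < N → ∃ λ y → F y ≡ l
  hit l l<N with l ℕ.<? T
  ... | yes l<T = hit-pair zero l l<T
  ... | no  l≮T =
    interval P T r (λ i i<r → inj₁ (hub (fromℕ< i<r) zero) , cong (T +_) (toℕ-fromℕ< i<r))
   -- The edges fill their block in reverse order, hence the index `r ∸ suc i`.
   (interval P (T + r) r (λ i i<r → inj₂ (hub-edge (fromℕ< (i′<r i i<r))) ,
      trans (cong (λ k → N ∸ suc (T + (r + k))) (toℕ-fromℕ< (i′<r i i<r))) (mirror i i<r))
   (interval P (T + r + r) r (λ i i<r → inj₁ (hub (fromℕ< i<r) (suc zero)) ,
      trans (cong (λ k → T + (2 * r + k)) (toℕ-fromℕ< i<r)) (eq₁ T r i))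
   (λ x lo x<N → let (y , eq) = hit-pair (suc zero) (N ∸ suc x) (low x lo x<N) in
      y , trans eq (trans (cong (_∸ suc (N ∸ suc x)) (sym (comp x x<N)))
                          (ℕ.m+n∸n≡m x (suc (N ∸ suc x)))))))
   l (ℕ.≮⇒≥ l≮T) l<N
    where
    P : ℕ → Set
    P x = ∃ λ y → F y ≡ x
    eq₁ : ∀ T r i → T + (2 * r + i) ≡ T + r + r + i
    eq₁ = solve-∀
    i′<r : ∀ i → i < r → r ∸ suc i < r
    i′<r i i<r = ℕ.∸-monoʳ-< (s≤s z≤n) i<r
    comp : ∀ x → x < N → x + suc (N ∸ suc x) ≡ N
    comp x x<N = trans (ℕ.+-suc x _) (ℕ.m+[n∸m]≡n x<N)
    mirror : ∀ i → i < r → N ∸ suc (T + (r + (r ∸ suc i))) ≡ T + r + i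
    mirror i i<r =
      trans (cong (_∸ suc (T + (r + k))) N≡) (ℕ.m+n∸n≡m (T + r + i) (suc (T + (r + k))))
      where
      k = r ∸ suc i
      r≡ : suc i + k ≡ r
      r≡ = ℕ.m+[n∸m]≡n i<r
      eq₂ : ∀ T r → 2 * T + 3 * r ≡ 2 * T + 2 * r + r
      eq₂ = solve-∀
      eq₃ : ∀ T r i k → 2 * T + 2 * r + (suc i + k) ≡ T + r + i + suc (T + (r + k))
      eq₃ = solve-∀
      N≡ : N ≡ T + r + i + suc (T + (r + k))
      N≡ = trans (eq₂ T r) (trans (cong (2 * T + 2 * r +_) (sym r≡)) (eq₃ T r i k))
    low : ∀ x → T + r + r + r ≤ x → x < N → N ∸ suc x < T
    low x lo x<N = ℕ.+-cancelˡ-≤ (T + r + r + r) _ _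
      (ℕ.≤-trans (ℕ.+-monoˡ-≤ _ lo) (ℕ.≤-reflexive (trans (comp x x<N) (eq₂ T r))))
      where
      eq₂ : ∀ T r → 2 * T + 3 * r ≡ T + r + r + r + T
      eq₂ = solve-∀

  order+size : order + size ≡ N
  order+size = eq r t
    where
    eq : ∀ r t → let n = 1 + 2 * suc t in
      r * 2 + n + (r * 1 + (n + r * 2 * n)) ≡ 2 * ((1 + 2 * t) * r + (2 * r + n)) + 3 * r
    eq = solve-∀

  private
    bijection : ∃ λ (f : (V ⊎ E) ⤖ Fin (order + size)) → ∀ x → toℕ (Bijection.to f x) ≡ F x
    bijection = covering⇒bijection (↔-sym +↔⊎ ↔-∘ (V-finite ⊎-↔ E-finite)) F
      λ l → hit (toℕ l) (subst (toℕ l <_) order+size (toℕ<n l))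

  f : Labelling G
  f = proj₁ bijection

  -- Colours of the labelling

  label-F : ∀ x → label G f x ≡ suc (F x)
  label-F x = cong suc (proj₂ bijection x)

  -- Read off from the bijection, without a case analysis of `F`.
  F<N : ∀ x → F x < N
  F<N x = subst (_< N) (proj₂ bijection x)
    (subst (toℕ (Bijection.to f x) <_) order+size (toℕ<n (Bijection.to f x)))

  complement : ∀ {x} → x < N → suc x + (N ∸ suc x) ≡ N
  complement = ℕ.m+[n∸m]≡n

  pair-sum : ∀ {x} p → x < N → suc (pair p x) + suc (pair (opposite p) x) ≡ suc N
  pair-sum {x} zero       x<N = trans (ℕ.+-suc (suc x) _) (cong suc (complement x<N))
  pair-sum {x} (suc zero) x<N = cong suc (trans (ℕ.+-comm _ (suc x)) (complement x<N))

  zig-sum : ∀ l p x → x + l * r < N → suc (zig p x l) + suc (zig (opposite p) x l) ≡ suc N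
  zig-sum zero    p x x<N = pair-sum p (subst (_< N) (ℕ.+-identityʳ x) x<N)
  zig-sum (suc l) p x x<N =
    zig-sum l (opposite p) (x + r) (subst (_< N) (sym (ℕ.+-assoc x r (l * r))) x<N)

  row : Fin 2 → Fin r → Fin n → ℕ
  row p i j = suc (spokes (toℕ i) p (toℕ j))

  spokes-sum : ∀ i j → row zero i j + row (suc zero) i j ≡ suc N
  spokes-sum i j = go (toℕ j) (toℕ<n j)
    where
    eq₁ : ∀ t → 1 + 2 * suc t ≡ suc (suc (suc (2 * t)))
    eq₁ = solve-∀
    eq₂ : ∀ r t → let b = (1 + 2 * t) * r; n = 1 + 2 * suc t in
      r + 2 * t * r + (b + 7 * r + 2 * n) ≡ 2 * (b + (2 * r + n)) + 3 * r
    eq₂ = solve-∀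
    small : ∀ l → l ≤ 2 * t → toℕ i + l * r < N
    small l l≤2t = ℕ.<-≤-trans (ℕ.+-mono-<-≤ (toℕ<n i) (ℕ.*-monoˡ-≤ r l≤2t))
      (ℕ.≤-trans (ℕ.m≤m+n (r + 2 * t * r) (base + 7 * r + 2 * n)) (ℕ.≤-reflexive (eq₂ r t)))
    go : ∀ k → k < n → suc (spokes (toℕ i) zero k) + suc (spokes (toℕ i) (suc zero) k) ≡ suc N
    go 0             _   = pair-sum zero (F<N (inj₂ (spoke i zero zero)))
    go 1             _   = pair-sum zero (F<N (inj₂ (spoke i zero (suc zero))))
    go (suc (suc l)) k<n with s≤s (s≤s (s≤s l≤2t)) ← subst (suc (suc l) <_) (eq₁ t) k<n =
      zig-sum l (suc zero) (toℕ i) (small l l≤2t)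

  -- Two neighbouring columns contribute `suc x` and `N` minus `x + r`, together `suc N` minus `r`,
  -- whatever `x` is.
  zig-low-total : ∀ k x → x + k * (r + r) < N →
    ∑[ l < k + k ] suc (zig zero x (toℕ l)) + k * r ≡ k * suc N
  zig-low-total zero    x _ = refl
  zig-low-total (suc k) x x<N rewrite ℕ.+-suc k k = begin
    suc x + (suc (N ∸ suc (x + r)) + rest) + (r + k * r)
      ≡⟨ eq₁ x (N ∸ suc (x + r)) rest r (k * r) ⟩
    suc (suc (x + r) + (N ∸ suc (x + r))) + (rest + k * r)
      ≡⟨ cong₂ (λ a b → suc a + b) (complement x+r<N) (zig-low-total k (x + r + r) inner) ⟩
    suc N + k * suc N ∎
    where
    rest = ∑[ l < k + k ] suc (zig zero (x + r + r) (toℕ l))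
    eq₁ : ∀ x c z r w → suc x + (suc c + z) + (r + w) ≡ suc (suc (x + r) + c) + (z + w)
    eq₁ = solve-∀
    eq₂ : ∀ x r w → x + r + r + w ≡ x + (r + r + w)
    eq₂ = solve-∀
    inner : x + r + r + k * (r + r) < N
    inner = subst (_< N) (sym (eq₂ x r (k * (r + r)))) x<N
    x+r<N : x + r < N
    x+r<N = ℕ.≤-<-trans (ℕ.≤-trans (ℕ.m≤m+n (x + r) r) (ℕ.m≤m+n _ _)) inner

  -- The first three columns have a constant sum, as `A i + B i` exceeds `κ` by `i` and the third
  -- label is the complement of `i`; the other `2 * t` columns are taken in twos.
  low-row : ∀ i → ∑[ j < n ] row zero i j + t * r ≡ M κ
  low-row i = ℕ.+-cancelʳ-≡ x _ _ (begin
    ∑[ j < n ] suc (spokes x zero (toℕ j)) + t * r + x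
      ≡⟨ cong (λ m → ∑[ j < m ] suc (spokes x zero (toℕ j)) + t * r + x) (eq₁ t) ⟩
    suc (base + A x) + (suc (base + B x) + (suc (N ∸ suc x) + z)) + t * r + x
      ≡⟨ eq₂ base (A x) (B x) (N ∸ suc x) z (t * r) x ⟩
    2 + 2 * base + (A x + B x) + (suc x + (N ∸ suc x)) + (z + t * r)
      ≡⟨ cong₂ _+_ (cong₂ (λ a b → 2 + 2 * base + a + b) (A+B x) (complement x<N))
                   (zig-low-total t (x + r) bound) ⟩
    2 + 2 * base + (κ + x) + N + t * suc N
      ≡⟨ eq₃ base κ x N (t * suc N) ⟩
    M κ + x ∎)
    where
    x = toℕ i
    z = ∑[ l < t + t ] suc (zig zero (x + r) (toℕ l))
    eq₁ : ∀ t → 1 + 2 * suc t ≡ 3 + (t + t)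
    eq₁ = solve-∀
    eq₂ : ∀ b a b′ c z w x → suc (b + a) + (suc (b + b′) + (suc c + z)) + w + x ≡
                             2 + 2 * b + (a + b′) + (suc x + c) + (z + w)
    eq₂ = solve-∀
    eq₃ : ∀ b k x N w → 2 + 2 * b + (k + x) + N + w ≡ 2 + 2 * b + k + N + w + x
    eq₃ = solve-∀
    eq₄ : ∀ r t → let b = (1 + 2 * t) * r; n = 1 + 2 * suc t in
      r + r + t * (r + r) + (b + 6 * r + 2 * n) ≡ 2 * (b + (2 * r + n)) + 3 * r
    eq₄ = solve-∀
    bound : x + r + t * (r + r) < N
    bound = ℕ.<-≤-trans (ℕ.+-monoˡ-< (t * (r + r)) (ℕ.+-monoˡ-< r (toℕ<n i)))
      (ℕ.≤-trans (ℕ.m≤m+n _ (base + 6 * r + 2 * n)) (ℕ.≤-reflexive (eq₄ r t)))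
    x<N : x < N
    x<N = ℕ.≤-<-trans (ℕ.≤-trans (ℕ.m≤m+n x r) (ℕ.m≤m+n (x + r) _)) bound

  rows : ∀ i → ∑[ j < n ] row zero i j + ∑[ j < n ] row (suc zero) i j ≡ n * suc N
  rows i = trans (sym (∑-distrib-+ {n} (row zero i) (row (suc zero) i)))
                 (trans (sum-cong-≗ {n} (spokes-sum i)) (∑-const n (suc N)))

  ∑rim : ∑[ j < n ] suc (base + X (toℕ j)) ≡ x̄ ω
  ∑rim = trans (∑-distrib-+ {n} (λ _ → suc base) (X ∘ toℕ)) (cong₂ _+_ (∑-const n (suc base)) ∑X)

  spoke-sums : ∀ i p → ∑[ j < n ] (label G f (inj₂ (spoke i p j)) + label G f (inj₁ (rim j))) ≡
                       ∑[ j < n ] row p i j + x̄ ω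
  spoke-sums i p =
    trans (sum-cong-≗ {n} λ j → cong₂ _+_ (label-F (inj₂ (spoke i p j))) (label-F (inj₁ (rim j))))
    (trans (∑-distrib-+ {n} (row p i) (λ j → suc (base + X (toℕ j))))
           (cong (∑[ j < n ] row p i j +_) ∑rim))

  hub-edge-bound : ∀ (i : Fin r) → T + (r + toℕ i) < N
  hub-edge-bound i = ℕ.≤-<-trans
    (ℕ.+-monoʳ-≤ T (ℕ.+-monoˡ-≤ (toℕ i) (ℕ.m≤m+n r (r + 0)))) (F<N (inj₁ (hub i (suc zero))))

  -- The edge of `K₂` and its far end together have label sum `suc (N + r)`.
  colour-low : ∀ i → colour G f (hub i zero) + t * r ≡ suc (N + r) + M κ + x̄ ω
  colour-low i = begin
    colour G f (hub i zero) + t * r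
      ≡⟨ cong (_+ t * r) (trans (colour-hub r s 3≤n f i zero) (cong₂ _+_
           (cong₂ _+_ (label-F (inj₂ (hub-edge i))) (label-F (inj₁ (hub i (suc zero)))))
           (spoke-sums i zero))) ⟩
    suc (N ∸ suc e) + suc (T + (2 * r + toℕ i)) + (low + x̄ ω) + t * r
      ≡⟨ eq (N ∸ suc e) T r (toℕ i) low (x̄ ω) (t * r) ⟩
    suc (suc e + (N ∸ suc e) + r) + (low + t * r) + x̄ ω
      ≡⟨ cong₂ (λ a b → suc (a + r) + b + x̄ ω) (complement (hub-edge-bound i)) (low-row i) ⟩
    suc (N + r) + M κ + x̄ ω ∎
    where
    e = T + (r + toℕ i)
    low = ∑[ j < n ] row zero i j
    eq : ∀ c T r i z x w → suc c + suc (T + (2 * r + i)) + (z + x) + w ≡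
                           suc (suc (T + (r + i)) + c + r) + (z + w) + x
    eq = solve-∀

  -- Edge and far end now give `suc N` minus `r`, and the spokes give what `low-row` leaves of
  -- `n * suc N`.
  colour-high : ∀ i → colour G f (hub i (suc zero)) + (r + M κ) ≡ suc N + x̄ ω + n * suc N + t * r
  colour-high i = begin
    colour G f (hub i (suc zero)) + (r + M κ)
      ≡⟨ cong₂ (λ a b → a + (r + b)) (trans (colour-hub r s 3≤n f i (suc zero)) (cong₂ _+_
           (cong₂ _+_ (label-F (inj₂ (hub-edge i))) (label-F (inj₁ (hub i zero))))
           (spoke-sums i (suc zero))))
           (sym (low-row i)) ⟩
    suc (N ∸ suc e) + suc (T + toℕ i) + (high + x̄ ω) + (r + (low + t * r))
      ≡⟨ eq (N ∸ suc e) T r (toℕ i) low high (x̄ ω) (t * r) ⟩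
    suc (suc e + (N ∸ suc e)) + x̄ ω + (low + high) + t * r
      ≡⟨ cong₂ (λ a b → suc a + x̄ ω + b + t * r) (complement (hub-edge-bound i)) (rows i) ⟩
    suc N + x̄ ω + n * suc N + t * r ∎
    where
    e = T + (r + toℕ i)
    low = ∑[ j < n ] row zero i j
    high = ∑[ j < n ] row (suc zero) i j
    eq : ∀ c T r i z z′ x w → suc c + suc (T + i) + (z′ + x) + (r + (z + w)) ≡
                              suc (suc (T + (r + i)) + c) + x + (z + z′) + w
    eq = solve-∀

  ∑hubs : ∑[ i < r ] (suc (T + toℕ i) + suc (T + (2 * r + toℕ i))) ≡ r * suc N
  ∑hubs = ℕ.+-cancelʳ-≡ r _ _ (begin
    ∑[ i < r ] (suc (T + toℕ i) + suc (T + (2 * r + toℕ i))) + r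
      ≡⟨ cong (_+ r) (sum-cong-≗ {r} λ i → eq₁ T r (toℕ i)) ⟩
    ∑[ i < r ] (2 + 2 * T + 2 * r + 2 * toℕ i) + r
      ≡⟨ ∑-arithmetic r (2 + 2 * T + 2 * r) ⟩
    r * (2 + 2 * T + 2 * r) + r * r
      ≡⟨ eq₂ T r ⟩
    r * suc N + r ∎)
    where
    eq₁ : ∀ T r i → suc (T + i) + suc (T + (2 * r + i)) ≡ 2 + 2 * T + 2 * r + 2 * i
    eq₁ = solve-∀
    eq₂ : ∀ T r → r * (2 + 2 * T + 2 * r) + r * r ≡ r * suc (2 * T + 3 * r) + r
    eq₂ = solve-∀

  ∑spokes : ∀ j →
    ∑[ i < r ] ∑[ p < 2 ] (label G f (inj₂ (spoke i p j)) + label G f (inj₁ (hub i p))) ≡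
    2 * r * suc N
  ∑spokes j = begin
    ∑[ i < r ] ∑[ p < 2 ] (label G f (inj₂ (spoke i p j)) + label G f (inj₁ (hub i p)))
      ≡⟨ sum-cong-≗ {r} (λ i → trans
           (cong₂ (λ a b → a + (b + 0))
             (cong₂ _+_ (label-F (inj₂ (spoke i zero j))) (label-F (inj₁ (hub i zero))))
             (cong₂ _+_ (label-F (inj₂ (spoke i (suc zero) j))) (label-F (inj₁ (hub i (suc zero))))))
           (trans (eq₁ (row zero i j) (suc (T + toℕ i)) (row (suc zero) i j) (suc (T + (2 * r + toℕ i))))
                  (cong (_+ (suc (T + toℕ i) + suc (T + (2 * r + toℕ i)))) (spokes-sum i j)))) ⟩
    ∑[ i < r ] (suc N + (suc (T + toℕ i) + suc (T + (2 * r + toℕ i))))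
      ≡⟨ ∑-distrib-+ {r} (λ _ → suc N) (λ i → suc (T + toℕ i) + suc (T + (2 * r + toℕ i))) ⟩
    ∑[ i < r ] suc N + ∑[ i < r ] (suc (T + toℕ i) + suc (T + (2 * r + toℕ i)))
      ≡⟨ cong₂ _+_ (∑-const r (suc N)) ∑hubs ⟩
    r * suc N + r * suc N
      ≡⟨ eq₂ r (suc N) ⟩
    2 * r * suc N ∎
    where
    eq₁ : ∀ a b c d → a + b + (c + d + 0) ≡ a + c + (b + d)
    eq₁ = solve-∀
    eq₂ : ∀ r K → r * K + r * K ≡ 2 * r * K
    eq₂ = solve-∀

  -- The edge and the vertex before `j` are complementary, and the edge after `j` is complementary
  -- to `j` itself; so beyond constants only the label of `next j` minus that of `j` remains.
  colour-step : ∀ j → colour G f (rim j) + X (toℕ j) ≡ X (toℕ (next j)) + W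
  colour-step j = ℕ.+-cancelʳ-≡ (suc base) _ _ (begin
    colour G f (rim j) + x + suc base
      ≡⟨ cong (λ c → c + x + suc base) (trans (colour-rim r s 3≤n f j) (cong₂ _+_ (cong₂ _+_
           (cong₂ _+_ (label-F (inj₂ (rim-edge j))) (label-F (inj₁ (rim (next j)))))
           (cong₂ _+_ (label-F (inj₂ (rim-edge (prev j)))) (label-F (inj₁ (rim (prev j))))))
           (∑spokes j))) ⟩
    suc (N ∸ suc (base + x)) + suc (base + x⁺) +
      (suc (N ∸ suc (base + x⁻)) + suc (base + x⁻)) + 2 * r * suc N + x + suc base
      ≡⟨ eq₁ (N ∸ suc (base + x)) base x x⁺
             (suc (N ∸ suc (base + x⁻)) + suc (base + x⁻)) (2 * r * suc N) ⟩
    suc (suc (base + x) + (N ∸ suc (base + x))) +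
      (suc (N ∸ suc (base + x⁻)) + suc (base + x⁻)) + 2 * r * suc N + x⁺ + suc base
      ≡⟨ cong₂ (λ a b → suc a + b + 2 * r * suc N + x⁺ + suc base)
           (complement (F<N (inj₁ (rim j)))) (pair-sum (suc zero) (F<N (inj₁ (rim (prev j))))) ⟩
    suc N + suc N + 2 * r * suc N + x⁺ + suc base
      ≡⟨ eq₂ (suc N) r x⁺ (suc base) ⟩
    x⁺ + W + suc base ∎)
    where
    x  = X (toℕ j)
    x⁺ = X (toℕ (next j))
    x⁻ = X (toℕ (prev j))
    eq₁ : ∀ c b x y z w → suc c + suc (b + y) + z + w + x + suc b ≡
                          suc (suc (b + x) + c) + z + w + y + suc b
    eq₁ = solve-∀
    eq₂ : ∀ K r y b → K + K + 2 * r * K + y + b ≡ y + (2 + 2 * r) * K + b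
    eq₂ = solve-∀

  open Colours r t lay (λ i → colour G f (hub i zero)) (λ i → colour G f (hub i (suc zero)))
    (λ j → colour G f (rim j)) colour-low colour-high colour-step

  colour-listed : ∀ v → colour G f v ∈ colours
  colour-listed (inj₁ (i , zero))     = low-listed i
  colour-listed (inj₁ (i , suc zero)) = high-listed i
  colour-listed (inj₂ j)              = rim-listed j

  ends-differ : ∀ e → colour G f (proj₁ (ends e)) ≢ colour G f (proj₂ (ends e))
  ends-differ (inj₁ (i , zero))                  = ℕ.<⇒≢ (high-below-low i i) ∘ sym
  ends-differ (inj₂ (inj₁ j))                    = rim-proper j
  ends-differ (inj₂ (inj₂ ((i , zero) , j)))     = low≢rim i j
  ends-differ (inj₂ (inj₂ ((i , suc zero) , j))) = high≢rim i j

  antimagic : IsLocalTotalNeighbourhoodAntimagic G f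
  antimagic = record { no-isolated = neighbour ; proper = proper }
    where
    neighbour : ∀ u → ∃ λ v → Graph.Adj G u v
    neighbour (inj₁ (i , p)) = rim zero , spoke i p zero , inj₁ refl
    neighbour (inj₂ j)       = rim (next j) , rim-edge j , inj₁ refl
    proper : ∀ {u v} → Graph.Adj G u v → colour G f u ≢ colour G f v
    proper (e , inj₁ refl) = ends-differ e
    proper (e , inj₂ refl) = ends-differ e ∘ sym

  #colours≤5 : #colours G f ≤ 5
  #colours≤5 = #colours≤ G f colours colour-listed

  χₗₜₙₐ≡5 : χₗₜₙₐ[ G ]≡ 5
  χₗₜₙₐ≡5 = record
    { attained = f , antimagic , ℕ.≤-antisym #colours≤5 (minimal f antimagic)
    ; minimal  = minimal
    }
    where
    minimal : ∀ f → IsLocalTotalNeighbourhoodAntimagic G f → 5 ≤ #colours G f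
    minimal = five≤#colours (fromℕ< (>-nonZero⁻¹ r)) s 3≤n

theorem2p7 : (r s : ℕ) → 1 ≤ r → (1≤s : 1 ≤ s) →
    χₗₜₙₐ[ copies r K₂ ∨ cycle (1 + 2 * s) (s≤s (*-monoʳ-≤ 2 1≤s)) ]≡ 5
theorem2p7 r (suc t) 1≤r 1≤s =
  Construction.χₗₜₙₐ≡5 r t {{>-nonZero 1≤r}} (layout r (suc t) 1≤r) (s≤s (*-monoʳ-≤ 2 1≤s))
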